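{- Let $p$ be a prime, $k$ a positive integer and $L=\{a\}\subset\mathbb{Z}/p\mathbb{Z}$ a single residue. Then $r(k,L,m)=O_k\!\left(m^{ -(p-1)k/p+p^2}\right)$ for all integers $m\ge2$.
   Context: Sets $F_1,\dots,F_t$ form an $L$-clique of size $t$ if $|F_i\cap F_j|\in L$ for all $i<j$. A family avoids intersections of size in $L$ if no two distinct members $F,F'$ satisfy $|F\cap F'|\in L$. For $L\subseteq\{0,\dots,k-1\}$, $r(k,L,m)$ is the supremum of all $\alpha\ge0$ such that whenever a finite set system $\mathcal F$ of $k$-element sets contains no $L$-clique of size $m$, there is $\mathcal F'\subseteq\mathcal F$ with $|\mathcal F'|\ge\alpha|\mathcal F|$ avoiding intersections of size in $L$. For $L\subseteq\mathbb Z/p\mathbb Z$, $r(k,L,m)$ means $r(k,L',m)$ with $L'=\{\ell\in\{0,\dots,k-1\}:\ell\bmod p\in L\}$. $O_k$ hides a multiplicative constant depending only on $k$. -}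

module Defs where

open import Data.Nat as ℕ using (ℕ; zero; suc; _<_)
open import Data.Fin using (Fin; toℕ)
open import Data.Fin.Subset using (Subset; _∩_; ∣_∣)
open import Data.List using (List; length)
open import Data.List.Relation.Unary.All using (All)
open import Data.List.Relation.Unary.AllPairs using (AllPairs)
open import Data.List.Relation.Unary.Unique.Propositional using (Unique)
open import Data.List.Relation.Binary.Sublist.Propositional using (_⊆_)
open import Data.Product using (Σ; ∃; _×_)
open import Relation.Binary.PropositionalEquality using (_≡_)
open import Relation.Nullary using (¬_)
import Data.Integer
open import Data.Rational using (ℚ; 0ℚ; 1ℚ; _*_; _≤_; _/_)

_^ℚ_ : ℚ → ℕ → ℚ
x ^ℚ zero = 1ℚ
x ^ℚ suc n = x * (x ^ℚ n)

ℕ→ℚ : ℕ → ℚ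
ℕ→ℚ n = Data.Integer.+ n / 1

InL' : (k p : ℕ) → Fin p → ℕ → Set
InL' k p a ℓ = (ℓ < k) × ∃ λ q → ℓ ≡ q ℕ.* p ℕ.+ toℕ a

-- a family of subsets of the finite ground set Fin n, given as a
-- duplicate-free list (i.e. a finite set of subsets)
Family : ℕ → Set
Family n = List (Subset n)

IsFamilyOfKSets : ∀ {n} → ℕ → Family n → Set
IsFamilyOfKSets k F = Unique F × All (λ A → ∣ A ∣ ≡ k) F

IsLClique : (k p : ℕ) → Fin p → ∀ {n} → Family n → Set
IsLClique k p a C = AllPairs (λ A B → InL' k p a ∣ A ∩ B ∣) C

HasLClique : (k p : ℕ) → Fin p → ℕ → ∀ {n} → Family n → Set
HasLClique k p a m F =
  Σ (Family _) λ C → (C ⊆ F) × Unique C × (length C ≡ m) × IsLClique k p a C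

AvoidsL : (k p : ℕ) → Fin p → ∀ {n} → Family n → Set
AvoidsL k p a F = AllPairs (λ A B → ¬ InL' k p a ∣ A ∩ B ∣) F

-- α is admissible in the definition of r(k,L,m): every finite family of
-- k-sets with no L-clique of size m has a subfamily of size ≥ α|F| avoiding L
Admissible : (k p : ℕ) → Fin p → ℕ → ℚ → Set
Admissible k p a m α =
  (0ℚ ≤ α) ×
  (∀ (n : ℕ) (F : Family n) → IsFamilyOfKSets k F → ¬ HasLClique k p a m F →
     Σ (Family n) λ F' → (F' ⊆ F) ×
       AvoidsL k p a F' × (α * ℕ→ℚ (length F) ≤ ℕ→ℚ (length F')))

module Submission where

open import Defs
import Algebra.Properties.CommutativeSemigroup as CommutativeSemigroupₚ
open import Algebra.Bundles using (CommutativeMonoid)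
open import Data.Bool as Bool using (true; false; if_then_else_)
open import Data.Fin as Fin using (Fin; zero; suc; toℕ; punchIn; punchOut; funToFin; finToFun; combine)
import Data.Fin.Properties as Finₚ
open import Data.Fin.Subset as Sub using (Subset; inside; outside; _∩_; _─_; ∣_∣; ⊤; ⁅_⁆)
import Data.Fin.Subset.Properties as Subₚ
open import Data.Integer as ℤ using (ℤ; 0ℤ; 1ℤ)
import Data.Integer.Divisibility.Signed as ℤ∣
import Data.Integer.Properties as ℤₚ
import Data.Integer.Tactic.RingSolver as ℤSolver
open import Data.List as List using (List; []; _∷_; length; filter; _++_; map; allFin)
import Data.List.Properties as Listₚ
open import Data.List.Membership.Propositional using (_∈_; find; lose)
open import Data.List.Membership.Propositional.Properties
  using (∈-lookup; ∈-filter⁺; ∈-filter⁻; ∈-++⁻; ∈-++⁺ˡ; ∈-++⁺ʳ; ∈-map⁺; ∈-AllPairs₂)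
open import Data.List.Relation.Binary.Sublist.Propositional using (_⊆_; []; _∷_; _∷ʳ_)
import Data.List.Relation.Binary.Sublist.Propositional.Properties as Sublistₚ
open import Data.List.Relation.Unary.All as All using ([]; _∷_)
import Data.List.Relation.Unary.All.Properties as Allₚ
open import Data.List.Relation.Unary.AllPairs using (AllPairs; []; _∷_)
import Data.List.Relation.Unary.AllPairs.Properties as AllPairsₚ
open import Data.List.Relation.Unary.Any as Any using (here; there)
open import Data.List.Relation.Unary.Unique.Propositional using (Unique)
import Data.List.Relation.Unary.Unique.Propositional.Properties as Uniqueₚ
open import Data.Nat as ℕ
  using (ℕ; zero; suc; _≤_; _<_; _+_; _*_; _^_; _∸_; z≤n; s≤s; NonZero)
import Data.Nat.Divisibility as ℕ∣
open import Data.Nat.DivMod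
  using (_/_; _%_; m≡m%n+[m/n]*n; m%n<n; m<n⇒m%n≡m; [m+kn]%n≡m%n; m/n*n≤m; m*n/n≡m; m≥n⇒m/n>0; /-monoˡ-≤)
open import Data.Nat.ListAction using (sum)
open import Data.Nat.Primality using (Prime; euclidsLemma; ¬prime[1])
import Data.Nat.Properties as ℕₚ
import Data.Nat.Tactic.RingSolver as ℕSolver
open import Data.Product using (Σ; ∃; _×_; _,_; proj₁; proj₂)
open import Data.Rational using (ℚ; 0ℚ; 1ℚ)
import Data.Rational as Q
import Data.Rational.Properties as ℚₚ
open import Data.Rational.Unnormalised as ℚᵘ using (mkℚᵘ)
import Data.Rational.Unnormalised.Properties as ℚᵘₚ
open import Data.Sum using (_⊎_; inj₁; inj₂)
open import Data.Vec as Vec using ([]; _∷_; here; there)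
import Data.Vec.Functional as VecF
import Data.Vec.Properties as Vecₚ
open import Function using (_∘_; id)
open import Relation.Binary.Definitions using (DecidableEquality; tri<; tri≈; tri>)
open import Relation.Binary.PropositionalEquality
  using (_≡_; _≢_; refl; sym; trans; cong; cong₂; subst; subst₂; module ≡-Reasoning)
open import Relation.Nullary using (¬_; Dec; yes; no; ¬?; contradiction; does; _×-dec_)
open import Relation.Nullary.Decidable as Dec using (decidable-stable; map′)
open import Relation.Unary using (Decidable)

-- Make the size incongruent to a: put k' = k if k ≢ a (mod p) and k' = k - 1 otherwise, and take
-- all functions [k'] → [N], as k'-partite sets in k' N points, each with an extra private point
-- if k' = k - 1. Since k' ≢ a, the vectors (1_A, -a) and (1_A, 1) show that an L-clique has at
-- most k' N + 1 members, so N of order m / k is allowed.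
--
-- It remains to bound a subfamily G without agreement sizes ≡ a by O_k(N^(k'/p + (p - 1)²)).
-- A delta-system argument reduces this to homogeneous G, in which the agreement sets are closed
-- under intersection; then G injects into [N]^T for any T contained in no agreement set.
-- If T is minimal, each i ∈ T has an agreement set M_i missing only i from T. Intersect the M_i
-- greedily, the one that removes most first. Steps removing at least p points number at most
-- k'/p, and for each d < p fewer than p steps remove d points, since p successive sizes
-- in arithmetic progression with difference d would hit the residue a. Hence |T| ≤ k'/p + (p - 1)².

-- Linear algebra and residues modulo p

dot : ∀ {d} → (Fin d → ℤ) → (Fin d → ℤ) → ℤ
dot {zero}  u v = 0ℤ
dot {suc d} u v = u zero ℤ.* v zero ℤ.+ dot (u ∘ suc) (v ∘ suc)

dot-linear : ∀ {d} (x y : ℤ) (u w v : Fin d → ℤ) →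
  dot (λ j → x ℤ.* u j ℤ.- y ℤ.* w j) v ≡ x ℤ.* dot u v ℤ.- y ℤ.* dot w v
dot-linear {zero}  x y u w v = cancel x y
  where
  cancel : ∀ x y → 0ℤ ≡ x ℤ.* 0ℤ ℤ.- y ℤ.* 0ℤ
  cancel = ℤSolver.solve-∀
dot-linear {suc d} x y u w v
  rewrite dot-linear x y (u ∘ suc) (w ∘ suc) (v ∘ suc) =
  distrib x y (u zero) (w zero) (v zero) (dot (u ∘ suc) (v ∘ suc)) (dot (w ∘ suc) (v ∘ suc))
  where
  distrib : ∀ x y a b c s t →
    (x ℤ.* a ℤ.- y ℤ.* b) ℤ.* c ℤ.+ (x ℤ.* s ℤ.- y ℤ.* t)
      ≡ x ℤ.* (a ℤ.* c ℤ.+ s) ℤ.- y ℤ.* (b ℤ.* c ℤ.+ t)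
  distrib = ℤSolver.solve-∀

module _ {p : ℕ} (p-prime : Prime p) where

  private
    P : ℤ
    P = ℤ.+ p

  prime-∤-* : ∀ {x y} → ¬ P ℤ∣.∣ x → ¬ P ℤ∣.∣ y → ¬ P ℤ∣.∣ x ℤ.* y
  prime-∤-* {x} {y} ¬x ¬y P∣xy
    with euclidsLemma ℤ.∣ x ∣ ℤ.∣ y ∣ p-prime (subst (p ℕ∣.∣_) (ℤₚ.abs-* x y) (ℤ∣.∣⇒∣ᵤ P∣xy))
  ... | inj₁ p∣x = ¬x (ℤ∣.∣ᵤ⇒∣ p∣x)
  ... | inj₂ p∣y = ¬y (ℤ∣.∣ᵤ⇒∣ p∣y)

  biorthogonal-≤ : ∀ {m d} (u v : Fin m → Fin d → ℤ) →
    (∀ i → ¬ P ℤ∣.∣ dot (u i) (v i)) → (∀ i j → i ≢ j → P ℤ∣.∣ dot (u i) (v j)) → m ≤ d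
  biorthogonal-≤ {zero}  u v diag off = z≤n
  biorthogonal-≤ {suc m} {zero} u v diag off = contradiction (ℤ∣.divides 0ℤ refl) (diag zero)
  biorthogonal-≤ {suc m} {suc d} u v diag off with Finₚ.any? (λ i → ¬? (P ℤ∣.∣? u i zero))
  ... | no none = ℕₚ.m≤n⇒m≤1+n (biorthogonal-≤ (λ i → u i ∘ suc) (λ i → v i ∘ suc)
          (λ i P∣ → diag i (ℤ∣.∣m∣n⇒∣m+n (first i i) P∣))
          (λ i j i≢j → ℤ∣.∣m+n∣m⇒∣n (off i j i≢j) (first i j)))
    where
    first : ∀ i j → P ℤ∣.∣ u i zero ℤ.* v j zero
    first i j = ℤ∣.∣m⇒∣m*n (v j zero) (decidable-stable (P ℤ∣.∣? u i zero) (λ ¬d → none (i , ¬d)))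
  ... | yes (i , pivot) = s≤s (biorthogonal-≤ u′ (λ l → v (punchIn i l) ∘ suc)
          (λ l P∣ → prime-∤-* pivot (diag (punchIn i l))
            (ℤ∣.∣m+n∣n⇒∣m (subst (P ℤ∣.∣_) (eliminated l l) P∣)
              (ℤ∣.∣m⇒∣-m (ℤ∣.∣n⇒∣m*n (u (punchIn i l) zero) (off i _ (Finₚ.punchInᵢ≢i i l ∘ sym))))))
          (λ l l′ l≢l′ → subst (P ℤ∣.∣_) (sym (eliminated l l′))
            (ℤ∣.∣m∣n⇒∣m-n
              (ℤ∣.∣n⇒∣m*n (u i zero) (off _ _ (l≢l′ ∘ Finₚ.punchIn-injective i l l′)))
              (ℤ∣.∣n⇒∣m*n (u (punchIn i l) zero) (off i _ (Finₚ.punchInᵢ≢i i l′ ∘ sym))))))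
    where
    row : Fin m → Fin (suc d) → ℤ
    row l j = u i zero ℤ.* u (punchIn i l) j ℤ.- u (punchIn i l) zero ℤ.* u i j
    u′ : Fin m → Fin d → ℤ
    u′ l = row l ∘ suc
    cancel : ∀ x y z s → s ≡ (x ℤ.* y ℤ.- y ℤ.* x) ℤ.* z ℤ.+ s
    cancel = ℤSolver.solve-∀
    eliminated : ∀ l l′ → dot (u′ l) (v (punchIn i l′) ∘ suc)
      ≡ u i zero ℤ.* dot (u (punchIn i l)) (v (punchIn i l′))
        ℤ.- u (punchIn i l) zero ℤ.* dot (u i) (v (punchIn i l′))
    eliminated l l′ =
      trans (cancel (u i zero) (u (punchIn i l) zero) (v (punchIn i l′) zero) _)
            (dot-linear (u i zero) (u (punchIn i l) zero) (u (punchIn i l)) (u i) (v (punchIn i l′)))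

%≡⇒∣∸ : ∀ p .{{_ : NonZero p}} {x δ} → x % p ≡ (x + δ) % p → p ℕ∣.∣ δ
%≡⇒∣∸ p {x} {δ} eq = ℕ∣.∣m+n∣m⇒∣n
  (subst (p ℕ∣.∣_) multiples (ℕ∣.n∣m*n ((x + δ) / p))) (ℕ∣.n∣m*n (x / p))
  where
  open ≡-Reasoning
  multiples : (x + δ) / p * p ≡ x / p * p + δ
  multiples = ℕₚ.+-cancelˡ-≡ (x % p) _ _ (begin
    x % p + (x + δ) / p * p        ≡⟨ cong (_+ (x + δ) / p * p) eq ⟩
    (x + δ) % p + (x + δ) / p * p  ≡⟨ m≡m%n+[m/n]*n (x + δ) p ⟨
    x + δ                          ≡⟨ cong (_+ δ) (m≡m%n+[m/n]*n x p) ⟩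
    x % p + x / p * p + δ          ≡⟨ ℕₚ.+-assoc (x % p) _ δ ⟩
    x % p + (x / p * p + δ)        ∎)

progression-%-injective : ∀ {p} → Prime p → .{{_ : NonZero p}} → ∀ c {d i j} →
  .{{_ : NonZero d}} → d < p → i < j → j < p →
  (c + i * d) % p ≢ (c + j * d) % p
progression-%-injective {p} p-prime c {d} {i} {j} d<p i<j j<p eq
  with euclidsLemma (j ∸ i) d p-prime (%≡⇒∣∸ p {c + i * d} (trans eq (cong (_% p) split)))
  where
  open ≡-Reasoning
  split : c + j * d ≡ c + i * d + (j ∸ i) * d
  split = begin
    c + j * d                  ≡⟨ cong (λ z → c + z * d) (ℕₚ.m+[n∸m]≡n (ℕₚ.<⇒≤ i<j)) ⟨
    c + (i + (j ∸ i)) * d      ≡⟨ cong (c +_) (ℕₚ.*-distribʳ-+ d i (j ∸ i)) ⟩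
    c + (i * d + (j ∸ i) * d)  ≡⟨ ℕₚ.+-assoc c _ _ ⟨
    c + i * d + (j ∸ i) * d    ∎
... | inj₁ p∣j∸i = ℕₚ.<⇒≱ (ℕₚ.≤-<-trans (ℕₚ.m∸n≤m j i) j<p)
                     (ℕ∣.∣⇒≤ {{ℕ.>-nonZero (ℕₚ.m<n⇒0<n∸m i<j)}} p∣j∸i)
... | inj₂ p∣d = ℕₚ.<⇒≱ d<p (ℕ∣.∣⇒≤ p∣d)

progression-hits-residue : ∀ {p} → Prime p → .{{_ : NonZero p}} → (a : Fin p) → ∀ c {d} →
  .{{_ : NonZero d}} → d < p → ¬ (∀ j → j < p → (c + j * d) % p ≢ toℕ a)
progression-hits-residue {suc n} p-prime a c {d} d<p avoids =
  ℕₚ.1+n≰n (Finₚ.injective⇒≤ {f = λ j → punchOut (a≢ j)}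
    (λ {i} {j} eq → injective (Finₚ.punchOut-injective (a≢ i) (a≢ j) eq)))
  where
  residue : Fin (suc n) → Fin (suc n)
  residue j = Fin.fromℕ< (m%n<n (c + toℕ j * d) (suc n))
  toℕ-residue : ∀ j → toℕ (residue j) ≡ (c + toℕ j * d) % suc n
  toℕ-residue j = Finₚ.toℕ-fromℕ< _
  a≢ : ∀ j → a ≢ residue j
  a≢ j eq = avoids (toℕ j) (Finₚ.toℕ<n j) (trans (sym (toℕ-residue j)) (cong toℕ (sym eq)))
  injective : ∀ {i j} → residue i ≡ residue j → i ≡ j
  injective {i} {j} eq = by-cases (ℕₚ.<-cmp (toℕ i) (toℕ j))
    where
    eq% : (c + toℕ i * d) % suc n ≡ (c + toℕ j * d) % suc n
    eq% = trans (sym (toℕ-residue i)) (trans (cong toℕ eq) (toℕ-residue j))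
    by-cases : _ → i ≡ j
    by-cases (tri< i<j _ _) = contradiction eq% (progression-%-injective p-prime c d<p i<j (Finₚ.toℕ<n j))
    by-cases (tri≈ _ i≡j _) = Finₚ.toℕ-injective i≡j
    by-cases (tri> _ _ j<i) = contradiction (sym eq%) (progression-%-injective p-prime c d<p j<i (Finₚ.toℕ<n i))

-- Closed sets and the greedy argument

∃∈? : ∀ {A : Set} {P : A → Set} → Decidable P → (xs : List A) → Dec (∃ λ x → x ∈ xs × P x)
∃∈? P? xs = map′ find (λ (x , x∈ , px) → lose x∈ px) (Any.any? P? xs)

lookup-injective : ∀ {A : Set} {xs : List A} → Unique xs →
  ∀ i j → List.lookup xs i ≡ List.lookup xs j → i ≡ j
lookup-injective (x∉ ∷ u) zero    zero    eq = refl
lookup-injective (x∉ ∷ u) zero    (suc j) eq = contradiction eq (All.lookup x∉ (∈-lookup j))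
lookup-injective (x∉ ∷ u) (suc i) zero    eq = contradiction (sym eq) (All.lookup x∉ (∈-lookup i))
lookup-injective (x∉ ∷ u) (suc i) (suc j) eq = cong suc (lookup-injective u i j eq)

unique-injective⇒≤ : ∀ {A : Set} {xs : List A} {n} → Unique xs → (f : A → Fin n) →
  (∀ {x y} → x ∈ xs → y ∈ xs → f x ≡ f y → x ≡ y) → length xs ≤ n
unique-injective⇒≤ {xs = xs} u f inj = Finₚ.injective⇒≤ {f = f ∘ List.lookup xs}
  (λ {i} {j} eq → lookup-injective u i j (inj (∈-lookup i) (∈-lookup j) eq))

∣p∣≡∣p∩q∣+∣p─q∣ : ∀ {n} (p q : Subset n) → ∣ p ∣ ≡ ∣ p ∩ q ∣ + ∣ p ─ q ∣
∣p∣≡∣p∩q∣+∣p─q∣ [] [] = refl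
∣p∣≡∣p∩q∣+∣p─q∣ (outside ∷ p) (inside  ∷ q) = ∣p∣≡∣p∩q∣+∣p─q∣ p q
∣p∣≡∣p∩q∣+∣p─q∣ (outside ∷ p) (outside ∷ q) = ∣p∣≡∣p∩q∣+∣p─q∣ p q
∣p∣≡∣p∩q∣+∣p─q∣ (inside  ∷ p) (inside  ∷ q) = cong suc (∣p∣≡∣p∩q∣+∣p─q∣ p q)
∣p∣≡∣p∩q∣+∣p─q∣ (inside  ∷ p) (outside ∷ q) =
  trans (cong suc (∣p∣≡∣p∩q∣+∣p─q∣ p q)) (sym (ℕₚ.+-suc ∣ p ∩ q ∣ ∣ p ─ q ∣))

x∈p⇒0<∣p∣ : ∀ {n} {p : Subset n} {x} → x Sub.∈ p → 0 < ∣ p ∣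
x∈p⇒0<∣p∣ here = s≤s z≤n
x∈p⇒0<∣p∣ {p = y ∷ p} (there x∈p) = ℕₚ.≤-trans (x∈p⇒0<∣p∣ x∈p) (Subₚ.∣p∣≤∣x∷p∣ y p)

x∈p─q⇒x∉q : ∀ {n} (p q : Subset n) {x} → x Sub.∈ p ─ q → x Sub.∉ q
x∈p─q⇒x∉q (_ ∷ p) (inside ∷ q) () here
x∈p─q⇒x∉q (_ ∷ p) (_ ∷ q) (there x∈) (there x∈q) = x∈p─q⇒x∉q p q x∈ x∈q

module GreedyBound {k q : ℕ} (p-prime : Prime (suc q)) (a : Fin (suc q))
  (Closed : Subset k → Set)
  (∩-closed : ∀ {C D} → Closed C → Closed D → Closed (C ∩ D))
  (avoids : ∀ {C} → Closed C → ∣ C ∣ % suc q ≢ toℕ a) where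

  record Independent (t : ℕ) (C : Subset k) (d : ℕ) : Set where
    field
      closed   : Closed C
      point    : Fin t → Fin k
      omit     : Fin t → Subset k
      omit-closed : ∀ i → Closed (omit i)
      point∈   : ∀ i → point i Sub.∈ C
      point∉   : ∀ i → point i Sub.∉ omit i
      others∈  : ∀ i j → j ≢ i → point j Sub.∈ omit i
      drop≤    : ∀ i → ∣ C ─ omit i ∣ ≤ d

  open Independent

  0<drop : ∀ {t C d} (I : Independent t C d) i → 0 < ∣ C ─ omit I i ∣
  0<drop I i = x∈p⇒0<∣p∣ (Subₚ.x∈p∧x∉q⇒x∈p─q (point∈ I i) (point∉ I i))

  t≡0 : ∀ {t C} → Independent t C 0 → t ≡ 0
  t≡0 {zero}  I = refl
  t≡0 {suc t} I = contradiction (ℕₚ.≤-trans (0<drop I zero) (drop≤ I zero)) λ()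

  select : ∀ {t C d} (I : Independent (suc t) C d) i → Independent t (C ∩ omit I i) d
  select {C = C} I i = record
    { closed      = ∩-closed (closed I) (omit-closed I i)
    ; point       = point I ∘ punchIn i
    ; omit        = omit I ∘ punchIn i
    ; omit-closed = omit-closed I ∘ punchIn i
    ; point∈      = λ j → Subₚ.x∈p∩q⁺ (point∈ I _ , others∈ I i _ (Finₚ.punchInᵢ≢i i j))
    ; point∉      = point∉ I ∘ punchIn i
    ; others∈     = λ j l l≢j → others∈ I _ _ (l≢j ∘ Finₚ.punchIn-injective i l j)
    ; drop≤       = λ j → ℕₚ.≤-trans (Subₚ.p⊆q⇒∣p∣≤∣q∣ (shrinks (omit I (punchIn i j)))) (drop≤ I _)
    }
    where
    shrinks : ∀ M → C ∩ omit I i ─ M Sub.⊆ C ─ M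
    shrinks M x∈ = Subₚ.x∈p∧x∉q⇒x∈p─q
      (proj₁ (Subₚ.x∈p∩q⁻ C _ (Subₚ.p─q⊆p (C ∩ omit I i) M x∈))) (x∈p─q⇒x∉q (C ∩ omit I i) M x∈)

  select-∣C∣ : ∀ {t C d} (I : Independent (suc t) C d) i {e} → ∣ C ─ omit I i ∣ ≡ e →
    ∣ C ∣ ≡ ∣ C ∩ omit I i ∣ + e
  select-∣C∣ {C = C} I i eq =
    trans (∣p∣≡∣p∩q∣+∣p─q∣ C (omit I i)) (cong (∣ C ∩ omit I i ∣ +_) eq)

  largest-drop : ∀ {t C d} (I : Independent t C (suc d)) →
    (∃ λ i → ∣ C ─ omit I i ∣ ≡ suc d) ⊎ Independent t C d
  largest-drop {C = C} {d} I with Finₚ.any? (λ i → ∣ C ─ omit I i ∣ ℕ.≟ suc d)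
  ... | yes found = inj₁ found
  ... | no none   = inj₂ record
    { Independent I
    ; drop≤ = λ i → ℕₚ.≤-pred (ℕₚ.≤∧≢⇒< (drop≤ I i) (λ eq → none (i , eq))) }

  -- After c steps of the same size d + 1 < p, the closed sets met so far have sizes
  -- ∣C∣, ∣C∣ + (d + 1), …, ∣C∣ + c (d + 1); for c = p - 1 these are all residues modulo p.
  few-equal-steps : ∀ {d} → suc d < suc q → (∀ {t C} → Independent t C d → t ≤ q * d) →
    ∀ t c {C} → Independent t C (suc d) →
    (∀ j → j ≤ c → (∣ C ∣ + j * suc d) % suc q ≢ toℕ a) → t + c ≤ q * suc d
  few-equal-steps {d} d<p below t c {C} I met with suc q ℕ.≤? suc c
  ... | yes p≤1+c = contradiction (λ j j<p → met j (ℕₚ.≤-pred (ℕₚ.≤-trans j<p p≤1+c)))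
                                  (progression-hits-residue p-prime a ∣ C ∣ d<p)
  ... | no p≰1+c with largest-drop I
  ...   | inj₂ I′ = begin
          t + c      ≤⟨ ℕₚ.+-mono-≤ (below I′) (ℕₚ.<⇒≤ (ℕₚ.≤-pred (ℕₚ.≰⇒> p≰1+c))) ⟩
          q * d + q  ≡⟨ ℕₚ.+-comm (q * d) q ⟩
          q + q * d  ≡⟨ ℕₚ.*-suc q d ⟨
          q * suc d  ∎
    where open ℕₚ.≤-Reasoning
  few-equal-steps {d} d<p below (suc t) c {C} I met | no p≰1+c | inj₁ (i , eq) =
    subst (_≤ q * suc d) (ℕₚ.+-suc t c) (few-equal-steps d<p below t (suc c) (select I i) met′)
    where
    met′ : ∀ j → j ≤ suc c → (∣ C ∩ omit I i ∣ + j * suc d) % suc q ≢ toℕ a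
    met′ zero    _         =
      subst (λ s → s % suc q ≢ toℕ a) (sym (ℕₚ.+-identityʳ ∣ C ∩ omit I i ∣)) (avoids (closed (select I i)))
    met′ (suc j) (s≤s j≤c) = subst (λ s → s % suc q ≢ toℕ a)
      (trans (cong (_+ j * suc d) (select-∣C∣ I i eq)) (ℕₚ.+-assoc ∣ C ∩ omit I i ∣ (suc d) (j * suc d)))
      (met j j≤c)

  small-drops-bound : ∀ d → d < suc q → ∀ {t C} → Independent t C d → t ≤ q * d
  small-drops-bound zero    d<p I = subst (_≤ q * 0) (sym (t≡0 I)) z≤n
  small-drops-bound (suc d) d<p {t} {C} I = subst (_≤ q * suc d) (ℕₚ.+-identityʳ t)
    (few-equal-steps d<p (small-drops-bound d (ℕₚ.<-trans (ℕₚ.n<1+n d) d<p)) t 0 I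
      λ { zero z≤n → subst (λ s → s % suc q ≢ toℕ a) (sym (ℕₚ.+-identityʳ ∣ C ∣)) (avoids (closed I)) })

  greedy-bound : ∀ e t {C} → Independent t C (e + q) →
    suc q * t ≤ ∣ C ∣ + suc q * (q * q)
  greedy-bound zero    t {C} I =
    ℕₚ.≤-trans (ℕₚ.*-monoʳ-≤ (suc q) (small-drops-bound q (ℕₚ.n<1+n q) I)) (ℕₚ.m≤n+m _ ∣ C ∣)
  greedy-bound (suc e) t {C} I with largest-drop I
  ... | inj₂ I′ = greedy-bound e t I′
  greedy-bound (suc e) (suc t) {C} I | inj₁ (i , eq) = begin
    suc q * suc t               ≡⟨ ℕₚ.*-suc (suc q) t ⟩
    suc q + suc q * t           ≤⟨ ℕₚ.+-mono-≤ (s≤s (ℕₚ.m≤n+m q e)) (greedy-bound (suc e) t (select I i)) ⟩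
    s + (∣ C ∩ omit I i ∣ + R)  ≡⟨ rearrange s ∣ C ∩ omit I i ∣ R ⟩
    ∣ C ∩ omit I i ∣ + s + R    ≡⟨ cong (_+ R) (select-∣C∣ I i eq) ⟨
    ∣ C ∣ + R                   ∎
    where
    open ℕₚ.≤-Reasoning
    s = suc e + q
    R = suc q * (q * q)
    rearrange : ∀ x y z → x + (y + z) ≡ y + x + z
    rearrange = ℕSolver.solve-∀

-- Agreement sets and peeling

module _ {A : Set} {P : A → Set} (P? : Decidable P) where

  length-filter-split : ∀ xs → length xs ≡ length (filter P? xs) + length (filter (¬? ∘ P?) xs)
  length-filter-split [] = refl
  length-filter-split (x ∷ xs) with P? x
  ... | yes _ = cong suc (length-filter-split xs)
  ... | no _  = trans (cong suc (length-filter-split xs)) (sym (ℕₚ.+-suc _ _))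

  length-filter-filter : ∀ {R : A → Set} (R? : Decidable R) xs →
    length (filter P? (filter R? xs)) ≤ length (filter P? xs)
  length-filter-filter R? [] = z≤n
  length-filter-filter R? (x ∷ xs) with R? x | P? x | length-filter-filter R? xs
  ... | yes _ | yes Px | le rewrite Listₚ.filter-accept P? {xs = filter R? xs} Px = s≤s le
  ... | yes _ | no ¬Px | le rewrite Listₚ.filter-reject P? {xs = filter R? xs} ¬Px = le
  ... | no _  | yes _  | le = ℕₚ.m≤n⇒m≤1+n le
  ... | no _  | no _   | le = le

popular-colour : ∀ {A : Set} {n} {Q : Fin n → A → Set} (Q? : ∀ j → Decidable (Q j)) xs →
  (∀ {z} → z ∈ xs → ∃ λ j → Q j z) →
  xs ≡ [] ⊎ ∃ λ j → length xs ≤ n * length (filter (Q? j) xs)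
popular-colour {n = zero} Q? [] coloured = inj₁ refl
popular-colour {n = zero} Q? (x ∷ xs) coloured with coloured (here refl)
... | () , _
popular-colour {n = suc n} {Q} Q? xs coloured = inj₂ (by-cases (popular-colour (Q? ∘ suc) rest coloured′))
  where
  open ℕₚ.≤-Reasoning
  rest = filter (¬? ∘ Q? zero) xs
  count : Fin (suc n) → ℕ
  count j = length (filter (Q? j) xs)
  coloured′ : ∀ {z} → z ∈ rest → ∃ λ j → Q (suc j) z
  coloured′ z∈ with ∈-filter⁻ (¬? ∘ Q? zero) {xs = xs} z∈
  ... | z∈xs , ¬Q₀ with coloured z∈xs
  ...   | zero  , Q₀ = contradiction Q₀ ¬Q₀
  ...   | suc j , Qⱼ = j , Qⱼ
  by-cases : _ → ∃ λ j → length xs ≤ suc n * count j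
  by-cases (inj₁ rest≡[]) = zero , (begin
    length xs                 ≡⟨ length-filter-split (Q? zero) xs ⟩
    count zero + length rest  ≡⟨ cong (λ ys → count zero + length ys) rest≡[] ⟩
    count zero + 0            ≤⟨ ℕₚ.+-monoʳ-≤ (count zero) z≤n ⟩
    suc n * count zero        ∎)
  by-cases (inj₂ (j , le)) with ℕₚ.≤-total (count zero) (count (suc j))
  ... | inj₁ c₀≤cⱼ = suc j , (begin
    length xs                 ≡⟨ length-filter-split (Q? zero) xs ⟩
    count zero + length rest
      ≤⟨ ℕₚ.+-mono-≤ c₀≤cⱼ (ℕₚ.≤-trans le (ℕₚ.*-monoʳ-≤ n (length-filter-filter (Q? (suc j)) (¬? ∘ Q? zero) xs))) ⟩
    suc n * count (suc j)     ∎)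
  ... | inj₂ cⱼ≤c₀ = zero , (begin
    length xs                 ≡⟨ length-filter-split (Q? zero) xs ⟩
    count zero + length rest
      ≤⟨ ℕₚ.+-monoʳ-≤ (count zero) (ℕₚ.≤-trans le (ℕₚ.*-monoʳ-≤ n (ℕₚ.≤-trans (length-filter-filter (Q? (suc j)) (¬? ∘ Q? zero) xs) cⱼ≤c₀))) ⟩
    suc n * count zero        ∎)

sum-map-≤ : ∀ {A : Set} (f : A → ℕ) {b} xs → (∀ {x} → x ∈ xs → f x ≤ b) → sum (map f xs) ≤ length xs * b
sum-map-≤ f []       f≤ = z≤n
sum-map-≤ f (x ∷ xs) f≤ = ℕₚ.+-mono-≤ (f≤ (here refl)) (sum-map-≤ f xs (f≤ ∘ there))

subsets : ∀ n → List (Subset n)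
subsets zero    = [] ∷ []
subsets (suc n) = map (inside ∷_) (subsets n) ++ map (outside ∷_) (subsets n)

∈-subsets : ∀ {n} (p : Subset n) → p ∈ subsets n
∈-subsets [] = here refl
∈-subsets (true  ∷ p) = ∈-++⁺ˡ (∈-map⁺ _ (∈-subsets p))
∈-subsets (false ∷ p) = ∈-++⁺ʳ _ (∈-map⁺ _ (∈-subsets p))

_≟ˢ_ : ∀ {n} → DecidableEquality (Subset n)
_≟ˢ_ = Vecₚ.≡-dec Bool._≟_

peelingConstant : ℕ → ℕ → ℕ
peelingConstant k zero    = 1
peelingConstant k (suc n) = 1 + k * (suc n * peelingConstant k n)

module Agreement {X : Set} (_≟_ : DecidableEquality X) {k N : ℕ} (col : X → Fin k → Fin N)
  (col-injective : ∀ {x y} → (∀ i → col x i ≡ col y i) → x ≡ y) where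

  agr : X → X → Subset k
  agr x y = Vec.tabulate (λ i → does (col x i Finₚ.≟ col y i))

  ∈agr⁺ : ∀ {x y i} → col x i ≡ col y i → i Sub.∈ agr x y
  ∈agr⁺ {x} {y} {i} eq = Vecₚ.lookup⇒[]= i _
    (trans (Vecₚ.lookup∘tabulate _ i) (Dec.dec-true (col x i Finₚ.≟ col y i) eq))

  ∈agr⁻ : ∀ {x y i} → i Sub.∈ agr x y → col x i ≡ col y i
  ∈agr⁻ {x} {y} {i} i∈ with col x i Finₚ.≟ col y i | trans (sym (Vecₚ.lookup∘tabulate (λ i → does (col x i Finₚ.≟ col y i)) i)) (Vecₚ.[]=⇒lookup i∈)
  ... | yes eq | _ = eq

  agr-refl : ∀ x i → i Sub.∈ agr x x
  agr-refl x i = ∈agr⁺ refl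

  agr-sym : ∀ {x y} → agr x y Sub.⊆ agr y x
  agr-sym = ∈agr⁺ ∘ sym ∘ ∈agr⁻

  ⊤⊆agr⇒≡ : ∀ {x y} → (∀ i → i Sub.∈ agr x y) → x ≡ y
  ⊤⊆agr⇒≡ all = col-injective (∈agr⁻ ∘ all)

  ∣agr∣<k : ∀ {x y} → x ≢ y → ∣ agr x y ∣ < k
  ∣agr∣<k {x} {y} x≢y = ℕₚ.≤∧≢⇒< (Subₚ.∣p∣≤n (agr x y)) λ eq →
    x≢y (⊤⊆agr⇒≡ λ i → subst (i Sub.∈_) (sym (Subₚ.∣p∣≡n⇒p≡⊤ eq)) Subₚ.∈⊤)

  -- Füredi's homogeneity asks for a large sunflower with kernel agr x y at every w; a single
  -- member z that avoids v outside the kernel is enough for closure under intersection.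
  Homogeneous : List X → Set
  Homogeneous H = ∀ {x y w v} → x ∈ H → y ∈ H → x ≢ y → w ∈ H → v ∈ H →
    ∃ λ z → z ∈ H × agr x y Sub.⊆ agr w z × agr v z Sub.⊆ agr x y

  IsAgreement : List X → Subset k → Set
  IsAgreement H J = ∃ λ x → ∃ λ y → x ∈ H × y ∈ H × x ≢ y × agr x y ≡ J

  ∩-agreement : ∀ {H} → Homogeneous H → ∀ {J K} →
    IsAgreement H J → IsAgreement H K → IsAgreement H (J ∩ K)
  ∩-agreement hom (x , y , x∈ , y∈ , x≢y , refl) (x′ , y′ , x′∈ , y′∈ , x′≢y′ , refl)
    with hom x′∈ y′∈ x′≢y′ y∈ x∈
  ... | z , z∈ , K⊆yz , xz⊆K = x , z , x∈ , z∈ , x≢z , Subₚ.⊆-antisym to from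
    where
    K = agr x′ y′
    x≢z : x ≢ z
    x≢z refl = x′≢y′ (⊤⊆agr⇒≡ λ i → xz⊆K (agr-refl x i))
    to : agr x z Sub.⊆ agr x y ∩ K
    to i∈ = Subₚ.x∈p∩q⁺ (∈agr⁺ (trans (∈agr⁻ i∈) (sym (∈agr⁻ (K⊆yz (xz⊆K i∈))))) , xz⊆K i∈)
    from : agr x y ∩ K Sub.⊆ agr x z
    from i∈ with Subₚ.x∈p∩q⁻ (agr x y) K i∈
    ... | i∈J , i∈K = ∈agr⁺ (trans (∈agr⁻ i∈J) (∈agr⁻ (K⊆yz i∈K)))

  Collision : ∀ {t} → List X → (Fin t → Fin k) → Set
  Collision H τ = ∃ λ x → x ∈ H × ∃ λ y → y ∈ H × x ≢ y × (∀ j → col x (τ j) ≡ col y (τ j))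

  collision? : ∀ {t} H (τ : Fin t → Fin k) → Dec (Collision H τ)
  collision? H τ = ∃∈? (λ x → ∃∈? (λ y → ¬? (x ≟ y) ×-dec Finₚ.all? (λ j → col x (τ j) Finₚ.≟ col y (τ j))) H) H

  minimal-separator : ∀ {H} t (τ : Fin t → Fin k) → ¬ Collision H τ →
    ∃ λ s → Σ (Fin s → Fin k) λ σ → ¬ Collision H σ ×
      (∀ i → ∃ λ x → x ∈ H × ∃ λ y → y ∈ H × x ≢ y × (∀ j → j ≢ i → col x (σ j) ≡ col y (σ j)))
  minimal-separator zero τ sep = zero , τ , sep , λ ()
  minimal-separator {H} (suc t) τ sep with Finₚ.all? (λ i → collision? H (τ ∘ punchIn i))
  ... | no some with Finₚ.¬∀⟶∃¬ (suc t) _ (λ i → collision? H (τ ∘ punchIn i)) some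
  ...   | i , sep′ = minimal-separator t (τ ∘ punchIn i) sep′
  minimal-separator {H} (suc t) τ sep | yes all = suc t , τ , sep , λ i → off i (all i)
    where
    off : ∀ i → Collision H (τ ∘ punchIn i) →
      ∃ λ x → x ∈ H × ∃ λ y → y ∈ H × x ≢ y × (∀ j → j ≢ i → col x (τ j) ≡ col y (τ j))
    off i (x , x∈ , y , y∈ , x≢y , eq) = x , x∈ , y , y∈ , x≢y , λ j j≢i →
      subst (λ j → col x (τ j) ≡ col y (τ j)) (Finₚ.punchIn-punchOut (j≢i ∘ sym)) (eq (punchOut (j≢i ∘ sym)))

  separator-bound : ∀ {H} → Unique H → ∀ {t} (τ : Fin t → Fin k) → ¬ Collision H τ → length H ≤ N ^ t
  separator-bound u τ sep = unique-injective⇒≤ u (λ x → funToFin (col x ∘ τ)) λ {x} {y} x∈ y∈ eq →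
    decidable-stable (x ≟ y) λ x≢y → sep (x , x∈ , y , y∈ , x≢y , λ j →
      trans (sym (Finₚ.finToFun-funToFin (col x ∘ τ) j))
        (trans (cong (λ c → finToFun c j) eq) (Finₚ.finToFun-funToFin (col y ∘ τ) j)))

  module _ {q : ℕ} (p-prime : Prime (suc q)) (a : Fin (suc q)) (k≢a : k % suc q ≢ toℕ a) where

    homogeneous-bound : .{{_ : NonZero N}} → ∀ {H} → Unique H → Homogeneous H →
      (∀ {x y} → x ∈ H → y ∈ H → x ≢ y → ∣ agr x y ∣ % suc q ≢ toℕ a) →
      length H ≤ N ^ ((k + suc q * (q * q)) / suc q)
    homogeneous-bound {H} u hom avoids with minimal-separator k id
      (λ (x , _ , y , _ , x≢y , eq) → x≢y (col-injective eq))
    ... | t , τ , sep , off = ℕₚ.≤-trans (separator-bound u τ sep) (ℕₚ.^-monoʳ-≤ N t≤)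
      where
      Closed : Subset k → Set
      Closed C = C ≡ ⊤ ⊎ IsAgreement H C
      ∩-closed : ∀ {C D} → Closed C → Closed D → Closed (C ∩ D)
      ∩-closed (inj₁ refl) closed = subst Closed (sym (Subₚ.∩-identityˡ _)) closed
      ∩-closed (inj₂ C∈) (inj₁ refl) = subst Closed (sym (Subₚ.∩-identityʳ _)) (inj₂ C∈)
      ∩-closed (inj₂ C∈) (inj₂ D∈) = inj₂ (∩-agreement hom C∈ D∈)
      closed-avoids : ∀ {C} → Closed C → ∣ C ∣ % suc q ≢ toℕ a
      closed-avoids (inj₁ refl) = subst (λ s → s % suc q ≢ toℕ a) (sym (Subₚ.∣⊤∣≡n k)) k≢a
      closed-avoids (inj₂ (_ , _ , x∈ , y∈ , x≢y , refl)) = avoids x∈ y∈ x≢y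
      open GreedyBound p-prime a Closed ∩-closed closed-avoids
      left right : Fin t → X
      left i  = proj₁ (off i)
      right i = proj₁ (proj₂ (proj₂ (off i)))
      matched : ∀ i j → j ≢ i → col (left i) (τ j) ≡ col (right i) (τ j)
      matched i = proj₂ (proj₂ (proj₂ (proj₂ (proj₂ (off i)))))
      I : Independent t ⊤ (k + q)
      I = record
        { closed      = inj₁ refl
        ; point       = τ
        ; omit        = λ i → agr (left i) (right i)
        ; omit-closed = λ i → let (x , x∈ , y , y∈ , x≢y , _) = off i in inj₂ (x , y , x∈ , y∈ , x≢y , refl)
        ; point∈      = λ i → Subₚ.∈⊤
        ; point∉      = λ i τi∈ → let (x , x∈ , y , y∈ , x≢y , eq) = off i in
            sep (x , x∈ , y , y∈ , x≢y , λ j → matched′ i (∈agr⁻ τi∈) j)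
        ; others∈     = λ i j j≢i → ∈agr⁺ (matched i j j≢i)
        ; drop≤       = λ i → ℕₚ.≤-trans (Subₚ.∣p∣≤n (⊤ ─ agr (left i) (right i))) (ℕₚ.m≤m+n k q)
        }
        where
        matched′ : ∀ i → col (left i) (τ i) ≡ col (right i) (τ i) → ∀ j → col (left i) (τ j) ≡ col (right i) (τ j)
        matched′ i eq j with j Finₚ.≟ i
        ... | yes refl = eq
        ... | no j≢i   = matched i j j≢i
      t≤ : t ≤ (k + suc q * (q * q)) / suc q
      t≤ = begin
        t                              ≡⟨ m*n/n≡m t (suc q) ⟨
        t * suc q / suc q              ≡⟨ cong (_/ suc q) (ℕₚ.*-comm t (suc q)) ⟩
        suc q * t / suc q
          ≤⟨ /-monoˡ-≤ (suc q) (subst (λ s → suc q * t ≤ s + _) (Subₚ.∣⊤∣≡n k) (greedy-bound k t I)) ⟩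
        (k + suc q * (q * q)) / suc q  ∎
        where open ℕₚ.≤-Reasoning

  agr-trans : ∀ {J x y z} → J Sub.⊆ agr x y → J Sub.⊆ agr y z → J Sub.⊆ agr x z
  agr-trans xy yz i∈ = ∈agr⁺ (trans (∈agr⁻ (xy i∈)) (∈agr⁻ (yz i∈)))

  Extension : List X → (x y w v : X) → Set
  Extension H x y w v = ∃ λ z → z ∈ H × agr x y Sub.⊆ agr w z × agr v z Sub.⊆ agr x y

  extension? : ∀ H x y w v → Dec (Extension H x y w v)
  extension? H x y w v = ∃∈? (λ z → agr x y Subₚ.⊆? agr w z ×-dec agr v z Subₚ.⊆? agr x y) H

  Obstruction : List X → Set
  Obstruction H = ∃ λ x → x ∈ H × ∃ λ y → y ∈ H × x ≢ y ×
    ∃ λ w → w ∈ H × ∃ λ v → v ∈ H × ¬ Extension H x y w v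

  obstruction? : ∀ H → Dec (Obstruction H)
  obstruction? H = ∃∈? (λ x → ∃∈? (λ y → ¬? (x ≟ y) ×-dec
    ∃∈? (λ w → ∃∈? (λ v → ¬? (extension? H x y w v)) H) H) H) H

  ¬obstruction⇒homogeneous : ∀ {H} → ¬ Obstruction H → Homogeneous H
  ¬obstruction⇒homogeneous {H} none {x} {y} {w} {v} x∈ y∈ x≢y w∈ v∈ =
    decidable-stable (extension? H x y w v) λ ¬z → none (x , x∈ , y , y∈ , x≢y , w , w∈ , v , v∈ , ¬z)

  extend : Subset k → List X → (Subset k → List X) → Subset k → List X
  extend J xs E K with K ≟ˢ J
  ... | yes _ = xs ++ E K
  ... | no _  = E K

  extend-∈⁻ : ∀ {J xs E x} K → x ∈ extend J xs E K → (K ≡ J × x ∈ xs) ⊎ x ∈ E K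
  extend-∈⁻ {J} {xs} K x∈ with K ≟ˢ J
  ... | no _ = inj₂ x∈
  ... | yes K≡J with ∈-++⁻ xs x∈
  ...   | inj₁ x∈xs = inj₁ (K≡J , x∈xs)
  ...   | inj₂ x∈E  = inj₂ x∈E

  extend-length : ∀ J xs E K → length (E K) ≤ length (extend J xs E K)
  extend-length J xs E K with K ≟ˢ J
  ... | yes _ = ℕₚ.≤-trans (ℕₚ.m≤n+m _ (length xs)) (ℕₚ.≤-reflexive (sym (Listₚ.length-++ xs)))
  ... | no _  = ℕₚ.≤-refl

  extend-length-≡ : ∀ J xs E → length (extend J xs E J) ≡ length xs + length (E J)
  extend-length-≡ J xs E with J ≟ˢ J
  ... | yes _  = Listₚ.length-++ xs
  ... | no J≢J = contradiction refl J≢J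

  extend-sum-≤ : ∀ J xs E Ks → sum (map (length ∘ E) Ks) ≤ sum (map (length ∘ extend J xs E) Ks)
  extend-sum-≤ J xs E []       = z≤n
  extend-sum-≤ J xs E (K ∷ Ks) = ℕₚ.+-mono-≤ (extend-length J xs E K) (extend-sum-≤ J xs E Ks)

  extend-sum : ∀ {J} xs E {Ks} → J ∈ Ks →
    length xs + sum (map (length ∘ E) Ks) ≤ sum (map (length ∘ extend J xs E) Ks)
  extend-sum {J} xs E {_ ∷ Ks} (here refl) = begin
    length xs + (length (E J) + sum (map (length ∘ E) Ks))            ≡⟨ ℕₚ.+-assoc (length xs) _ _ ⟨
    length xs + length (E J) + sum (map (length ∘ E) Ks)
      ≤⟨ ℕₚ.+-mono-≤ (ℕₚ.≤-reflexive (sym (extend-length-≡ J xs E))) (extend-sum-≤ J xs E Ks) ⟩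
    length (extend J xs E J) + sum (map (length ∘ extend J xs E) Ks)  ∎
    where open ℕₚ.≤-Reasoning
  extend-sum {J} xs E {K ∷ Ks} (there J∈) = begin
    length xs + (length (E K) + sum (map (length ∘ E) Ks))            ≡⟨ swap (length xs) (length (E K)) _ ⟩
    length (E K) + (length xs + sum (map (length ∘ E) Ks))
      ≤⟨ ℕₚ.+-mono-≤ (extend-length J xs E K) (extend-sum xs E J∈) ⟩
    length (extend J xs E K) + sum (map (length ∘ extend J xs E) Ks)  ∎
    where
    open ℕₚ.≤-Reasoning
    swap : ∀ x y z → x + (y + z) ≡ y + (x + z)
    swap = ℕSolver.solve-∀

  -- A stage of the peeling of G: H is what is left, and E J collects a positive proportion of
  -- the fibres removed because of J, chosen so that no two of its members agree exactly on J.
  record Peeling (G : List X) (Js : List (Subset k)) (H : List X) (E : Subset k → List X) : Set where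
    field
      H⊆G      : ∀ {x} → x ∈ H → x ∈ G
      H-unique : Unique H
      E⊆G      : ∀ J {x} → x ∈ E J → x ∈ G
      E-unique : ∀ J → Unique (E J)
      E-never  : ∀ J {x y} → x ∈ E J → y ∈ E J → agr x y ≢ J
      apart    : ∀ J {x y} → x ∈ E J → y ∈ H → ¬ J Sub.⊆ agr x y
      count    : length G ≤ length H + k * sum (map (length ∘ E) Js)

  open Peeling

  peel-step : ∀ {G Js H E} → (∀ {x y} → x ∈ G → y ∈ G → x ≢ y → agr x y ∈ Js) →
    Peeling G Js H E → Obstruction H → ∃ λ H′ → length H′ < length H × ∃ λ E′ → Peeling G Js H′ E′
  peel-step {G} {Js} {H} {E} agr∈Js S (x , x∈ , y , y∈ , x≢y , w , w∈ , v , v∈ , ¬z) =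
    by-cases (popular-colour Q? Φ coloured)
    where
    J = agr x y
    fibre? : ∀ z → Dec (J Sub.⊆ agr w z)
    fibre? z = J Subₚ.⊆? agr w z
    Φ H′ : List X
    Φ  = filter fibre? H
    H′ = filter (¬? ∘ fibre?) H
    Q? : ∀ j z → Dec (j Sub.∈ agr v z × j Sub.∉ J)
    Q? j z = (j Subₚ.∈? agr v z) ×-dec ¬? (j Subₚ.∈? J)
    ∈Φ⁻ : ∀ {z} → z ∈ Φ → z ∈ H × J Sub.⊆ agr w z
    ∈Φ⁻ = ∈-filter⁻ fibre? {xs = H}
    ∈H′⁻ : ∀ {z} → z ∈ H′ → z ∈ H × ¬ J Sub.⊆ agr w z
    ∈H′⁻ = ∈-filter⁻ (¬? ∘ fibre?) {xs = H}
    w∈Φ : w ∈ Φ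
    w∈Φ = ∈-filter⁺ fibre? w∈ (λ {i} _ → agr-refl w i)
    coloured : ∀ {z} → z ∈ Φ → ∃ λ j → j Sub.∈ agr v z × j Sub.∉ J
    coloured {z} z∈ = decidable-stable (Finₚ.any? (λ j → Q? j z)) λ none →
      ¬z (z , proj₁ (∈Φ⁻ z∈) , proj₂ (∈Φ⁻ z∈) , λ {j} j∈ →
        decidable-stable (j Subₚ.∈? J) (λ j∉ → none (j , j∈ , j∉)))
    shorter : length H′ < length H
    shorter = Listₚ.filter-notAll (¬? ∘ fibre?) H (lose w∈ (λ ¬w → ¬w (λ {i} _ → agr-refl w i)))
    by-cases : _ → ∃ λ H′ → length H′ < length H × ∃ λ E′ → Peeling G Js H′ E′
    by-cases (inj₁ Φ≡[]) with subst (w ∈_) Φ≡[] w∈Φ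
    ... | ()
    by-cases (inj₂ (j , Φ≤)) = H′ , shorter , extend J Ψ E , record
      { H⊆G      = H⊆G S ∘ proj₁ ∘ ∈H′⁻
      ; H-unique = Uniqueₚ.filter⁺ (¬? ∘ fibre?) (H-unique S)
      ; E⊆G      = λ K z∈ → E⊆G′ K (extend-∈⁻ K z∈)
      ; E-unique = E-unique′
      ; E-never  = λ K y∈ z∈ → E-never′ K (extend-∈⁻ K y∈) (extend-∈⁻ K z∈)
      ; apart    = λ K y∈ z∈ → apart′ K (extend-∈⁻ K y∈) (∈H′⁻ z∈)
      ; count    = count′
      }
      where
      Ψ : List X
      Ψ = filter (Q? j) Φ
      ∈Ψ⁻ : ∀ {z} → z ∈ Ψ → (z ∈ H × J Sub.⊆ agr w z) × (j Sub.∈ agr v z × j Sub.∉ J)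
      ∈Ψ⁻ z∈ = let (z∈Φ , Qz) = ∈-filter⁻ (Q? j) {xs = Φ} z∈ in ∈Φ⁻ z∈Φ , Qz
      E⊆G′ : ∀ K {z} → (K ≡ J × z ∈ Ψ) ⊎ z ∈ E K → z ∈ G
      E⊆G′ K (inj₁ (_ , z∈)) = H⊆G S (proj₁ (proj₁ (∈Ψ⁻ z∈)))
      E⊆G′ K (inj₂ z∈)       = E⊆G S K z∈
      E-unique′ : ∀ K → Unique (extend J Ψ E K)
      E-unique′ K with K ≟ˢ J
      ... | no _     = E-unique S K
      ... | yes refl = Uniqueₚ.++⁺ (Uniqueₚ.filter⁺ (Q? j) (Uniqueₚ.filter⁺ fibre? (H-unique S))) (E-unique S K)
        λ {z} (z∈Ψ , z∈E) → apart S K z∈E (proj₁ (proj₁ (∈Ψ⁻ z∈Ψ))) (λ {i} _ → agr-refl z i)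
      E-never′ : ∀ K {y z} → (K ≡ J × y ∈ Ψ) ⊎ y ∈ E K → (K ≡ J × z ∈ Ψ) ⊎ z ∈ E K → agr y z ≢ K
      E-never′ K (inj₁ (refl , y∈)) (inj₁ (_ , z∈)) eq with ∈Ψ⁻ y∈ | ∈Ψ⁻ z∈
      ... | _ , j∈vy , j∉J | _ , j∈vz , _ =
        j∉J (subst (j Sub.∈_) eq (∈agr⁺ (trans (sym (∈agr⁻ j∈vy)) (∈agr⁻ j∈vz))))
      E-never′ K (inj₁ (_ , y∈)) (inj₂ z∈) eq =
        apart S K z∈ (proj₁ (proj₁ (∈Ψ⁻ y∈))) (agr-sym ∘ subst (_ Sub.∈_) (sym eq))
      E-never′ K (inj₂ y∈) (inj₁ (_ , z∈)) eq =
        apart S K y∈ (proj₁ (proj₁ (∈Ψ⁻ z∈))) (subst (_ Sub.∈_) (sym eq))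
      E-never′ K (inj₂ y∈) (inj₂ z∈) = E-never S K y∈ z∈
      apart′ : ∀ K {y z} → (K ≡ J × y ∈ Ψ) ⊎ y ∈ E K → z ∈ H × ¬ J Sub.⊆ agr w z → ¬ K Sub.⊆ agr y z
      apart′ K (inj₁ (refl , y∈)) (_ , z∉) K⊆ = z∉ (agr-trans (proj₂ (proj₁ (∈Ψ⁻ y∈))) K⊆)
      apart′ K (inj₂ y∈) (z∈ , _) = apart S K y∈ z∈
      count′ : length G ≤ length H′ + k * sum (map (length ∘ extend J Ψ E) Js)
      count′ = begin
        length G                                              ≤⟨ count S ⟩
        length H + k * s                                      ≡⟨ cong (_+ k * s) (length-filter-split fibre? H) ⟩
        length Φ + length H′ + k * s                          ≤⟨ ℕₚ.+-monoˡ-≤ (k * s) (ℕₚ.+-monoˡ-≤ (length H′) Φ≤) ⟩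
        k * length Ψ + length H′ + k * s                      ≡⟨ rearrange k (length Ψ) (length H′) s ⟩
        length H′ + k * (length Ψ + s)
          ≤⟨ ℕₚ.+-monoʳ-≤ (length H′) (ℕₚ.*-monoʳ-≤ k (extend-sum Ψ E (agr∈Js (H⊆G S x∈) (H⊆G S y∈) x≢y))) ⟩
        length H′ + k * sum (map (length ∘ extend J Ψ E) Js)  ∎
        where
        open ℕₚ.≤-Reasoning
        s = sum (map (length ∘ E) Js)
        rearrange : ∀ k x y z → k * x + y + k * z ≡ y + k * (x + z)
        rearrange = ℕSolver.solve-∀

  peel : ∀ {G Js} → (∀ {x y} → x ∈ G → y ∈ G → x ≢ y → agr x y ∈ Js) →
    ∀ n {H E} → length H ≤ n → Peeling G Js H E → ∃ λ H′ → Homogeneous H′ × ∃ λ E′ → Peeling G Js H′ E′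
  peel agr∈Js n {H} {E} H≤n S with obstruction? H
  ... | no none = H , ¬obstruction⇒homogeneous none , E , S
  ... | yes obs with peel-step agr∈Js S obs
  peel agr∈Js zero    H≤n S | yes obs | H′ , H′<H , E′ , S′ = contradiction (ℕₚ.≤-trans H′<H H≤n) λ()
  peel agr∈Js (suc n) H≤n S | yes obs | H′ , H′<H , E′ , S′ =
    peel agr∈Js n (ℕₚ.≤-pred (ℕₚ.≤-trans H′<H H≤n)) S′

  peeling-bound : ∀ (A : List X) {b} →
    (∀ {H} → Unique H → (∀ {x} → x ∈ H → x ∈ A) → Homogeneous H → length H ≤ b) →
    ∀ n {Js} → length Js ≤ n → ∀ {G} → Unique G → (∀ {x} → x ∈ G → x ∈ A) →
    (∀ {x y} → x ∈ G → y ∈ G → x ≢ y → agr x y ∈ Js) → length G ≤ peelingConstant k n * b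
  peeling-bound A {b} hom-bound zero {[]} z≤n {G} u G⊆A agr∈Js =
    subst (length G ≤_) (sym (ℕₚ.*-identityˡ b))
      (hom-bound u G⊆A λ x∈ y∈ x≢y → contradiction (agr∈Js x∈ y∈ x≢y) λ())
  peeling-bound A {b} hom-bound (suc n) {Js} Js≤ {G} u G⊆A agr∈Js
    with peel {Js = Js} agr∈Js (length G) {E = λ _ → []} ℕₚ.≤-refl (record
      { H⊆G = id ; H-unique = u ; E⊆G = λ _ () ; E-unique = λ _ → []
      ; E-never = λ _ () ; apart = λ _ () ; count = ℕₚ.m≤m+n (length G) _ })
  ... | H , hom , E , S = begin
    length G                                  ≤⟨ count S ⟩
    length H + k * sum (map (length ∘ E) Js)  ≤⟨ ℕₚ.+-mono-≤ (hom-bound (H-unique S) (G⊆A ∘ H⊆G S) hom)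
                                                        (ℕₚ.*-monoʳ-≤ k (ℕₚ.≤-trans (sum-map-≤ (length ∘ E) Js E≤) (ℕₚ.*-monoˡ-≤ (c * b) Js≤))) ⟩
    b + k * (suc n * (c * b))      ≡⟨ rearrange k (suc n) c b ⟩
    peelingConstant k (suc n) * b  ∎
    where
    open ℕₚ.≤-Reasoning
    c = peelingConstant k n
    rearrange : ∀ k m c b → b + k * (m * (c * b)) ≡ (1 + k * (m * c)) * b
    rearrange = ℕSolver.solve-∀
    E≤ : ∀ {J} → J ∈ Js → length (E J) ≤ c * b
    E≤ {J} J∈ = peeling-bound A hom-bound n {filter (λ K → ¬? (K ≟ˢ J)) Js}
      (ℕₚ.≤-pred (ℕₚ.≤-trans (Listₚ.filter-notAll _ Js (lose J∈ (λ J≢J → J≢J refl))) Js≤))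
      (E-unique S J) (G⊆A ∘ E⊆G S J)
      λ x∈ y∈ x≢y → ∈-filter⁺ _ (agr∈Js (E⊆G S J x∈) (E⊆G S J y∈) x≢y) (E-never S J x∈ y∈)

  module _ {q : ℕ} (p-prime : Prime (suc q)) (a : Fin (suc q)) (k≢a : k % suc q ≢ toℕ a) where

    avoiding-bound : .{{_ : NonZero N}} → ∀ {G} → Unique G →
      (∀ {x y} → x ∈ G → y ∈ G → x ≢ y → ∣ agr x y ∣ % suc q ≢ toℕ a) →
      length G ≤ peelingConstant k (length (subsets k)) * N ^ ((k + suc q * (q * q)) / suc q)
    avoiding-bound {G} u avoids = peeling-bound G
      (λ uH H⊆G hom → homogeneous-bound p-prime a k≢a uH hom λ x∈ y∈ → avoids (H⊆G x∈) (H⊆G y∈))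
      (length (subsets k)) ℕₚ.≤-refl u id (λ {x} {y} _ _ _ → ∈-subsets (agr x y))

-- The set system

∣p++q∣≡∣p∣+∣q∣ : ∀ {m n} (p : Subset m) (q : Subset n) → ∣ p Vec.++ q ∣ ≡ ∣ p ∣ + ∣ q ∣
∣p++q∣≡∣p∣+∣q∣ []            q = refl
∣p++q∣≡∣p∣+∣q∣ (inside  ∷ p) q = cong suc (∣p++q∣≡∣p∣+∣q∣ p q)
∣p++q∣≡∣p∣+∣q∣ (outside ∷ p) q = ∣p++q∣≡∣p∣+∣q∣ p q

∣++∩++∣ : ∀ {m n} (p p′ : Subset m) (q q′ : Subset n) →
  ∣ (p Vec.++ q) ∩ (p′ Vec.++ q′) ∣ ≡ ∣ p ∩ p′ ∣ + ∣ q ∩ q′ ∣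
∣++∩++∣ p p′ q q′ =
  trans (cong ∣_∣ (Vecₚ.zipWith-++ _ p q p′ q′)) (∣p++q∣≡∣p∣+∣q∣ (p ∩ p′) (q ∩ q′))

∣⁅x⁆∩⁅x⁆∣≡1 : ∀ {n} (x : Fin n) → ∣ ⁅ x ⁆ ∩ ⁅ x ⁆ ∣ ≡ 1
∣⁅x⁆∩⁅x⁆∣≡1 x = trans (cong ∣_∣ (Subₚ.∩-idem ⁅ x ⁆)) (Subₚ.∣⁅x⁆∣≡1 x)

∣⁅x⁆∩⁅y⁆∣≡0 : ∀ {n} {x y : Fin n} → x ≢ y → ∣ ⁅ x ⁆ ∩ ⁅ y ⁆ ∣ ≡ 0
∣⁅x⁆∩⁅y⁆∣≡0 {n} {x} {y} x≢y = trans (cong ∣_∣ (Subₚ.Empty-unique disjoint)) (Subₚ.∣⊥∣≡0 n)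
  where
  disjoint : Sub.Empty (⁅ x ⁆ ∩ ⁅ y ⁆)
  disjoint (i , i∈) with Subₚ.x∈p∩q⁻ ⁅ x ⁆ ⁅ y ⁆ i∈
  ... | i∈x , i∈y = x≢y (trans (sym (Subₚ.x∈⁅y⁆⇒x≡y x i∈x)) (Subₚ.x∈⁅y⁆⇒x≡y y i∈y))

blocks : ∀ k {N} → (Fin k → Fin N) → Subset (k * N)
blocks zero    f = []
blocks (suc k) f = ⁅ f zero ⁆ Vec.++ blocks k (f ∘ suc)

∣blocks∩blocks∣ : ∀ k {N} (f g : Fin k → Fin N) →
  ∣ blocks k f ∩ blocks k g ∣ ≡ ∣ Vec.tabulate (λ i → does (f i Finₚ.≟ g i)) ∣
∣blocks∩blocks∣ zero    f g = refl
∣blocks∩blocks∣ (suc k) f g with ∣blocks∩blocks∣ k (f ∘ suc) (g ∘ suc) | f zero Finₚ.≟ g zero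
... | ih | yes f₀≡g₀ = trans (∣++∩++∣ ⁅ f zero ⁆ ⁅ g zero ⁆ _ _)
      (cong₂ _+_ (trans (cong (λ x → ∣ ⁅ f zero ⁆ ∩ ⁅ x ⁆ ∣) (sym f₀≡g₀)) (∣⁅x⁆∩⁅x⁆∣≡1 (f zero))) ih)
... | ih | no f₀≢g₀  = trans (∣++∩++∣ ⁅ f zero ⁆ ⁅ g zero ⁆ _ _) (cong₂ _+_ (∣⁅x⁆∩⁅y⁆∣≡0 f₀≢g₀) ih)

∣blocks∣ : ∀ k {N} (f : Fin k → Fin N) → ∣ blocks k f ∣ ≡ k
∣blocks∣ zero    f = refl
∣blocks∣ (suc k) f = trans (∣p++q∣≡∣p∣+∣q∣ ⁅ f zero ⁆ _) (cong₂ _+_ (Subₚ.∣⁅x⁆∣≡1 (f zero)) (∣blocks∣ k (f ∘ suc)))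

indicator : ∀ {n} → Subset n → Fin n → ℤ
indicator p i = if Vec.lookup p i then 1ℤ else 0ℤ

dot-indicator : ∀ {n} (p q : Subset n) → dot (indicator p) (indicator q) ≡ ℤ.+ ∣ p ∩ q ∣
dot-indicator [] [] = refl
dot-indicator (true  ∷ p) (true  ∷ q) = trans (cong (ℤ._+_ 1ℤ) (dot-indicator p q)) (sym (ℤₚ.pos-+ 1 _))
dot-indicator (true  ∷ p) (false ∷ q) = trans (ℤₚ.+-identityˡ _) (dot-indicator p q)
dot-indicator (false ∷ p) (true  ∷ q) = trans (ℤₚ.+-identityˡ _) (dot-indicator p q)
dot-indicator (false ∷ p) (false ∷ q) = trans (ℤₚ.+-identityˡ _) (dot-indicator p q)

∣-a+n⇒n%p≡a : ∀ {p} .{{_ : NonZero p}} (a : Fin p) n →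
  (ℤ.+ p) ℤ∣.∣ (ℤ.- (ℤ.+ toℕ a) ℤ.* 1ℤ ℤ.+ ℤ.+ n) → n % p ≡ toℕ a
∣-a+n⇒n%p≡a {p} a n p∣ = by-cases (ℕₚ.≤-total (toℕ a) n)
  where
  open ≡-Reasoning
  swap : ∀ x y → ℤ.- x ℤ.* 1ℤ ℤ.+ y ≡ y ℤ.+ ℤ.- x
  swap = ℤSolver.solve-∀
  p∣n⊖a : p ℕ∣.∣ ℤ.∣ n ℤ.⊖ toℕ a ∣
  p∣n⊖a = subst (p ℕ∣.∣_) (cong ℤ.∣_∣ (trans (swap (ℤ.+ toℕ a) (ℤ.+ n)) (ℤₚ.m-n≡m⊖n n (toℕ a))))
    (ℤ∣.∣⇒∣ᵤ p∣)
  p∣d<p⇒d≡0 : ∀ d → p ℕ∣.∣ d → d < p → d ≡ 0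
  p∣d<p⇒d≡0 zero    _   _   = refl
  p∣d<p⇒d≡0 (suc d) p∣d d<p = contradiction (ℕ∣.∣⇒≤ p∣d) (ℕₚ.<⇒≱ d<p)
  by-cases : toℕ a ≤ n ⊎ n ≤ toℕ a → n % p ≡ toℕ a
  by-cases (inj₁ a≤n) with subst (p ℕ∣.∣_) (cong ℤ.∣_∣ (ℤₚ.⊖-≥ a≤n)) p∣n⊖a
  ... | ℕ∣.divides c eq = begin
    n % p                      ≡⟨ cong (_% p) (ℕₚ.m+[n∸m]≡n a≤n) ⟨
    (toℕ a + (n ∸ toℕ a)) % p  ≡⟨ cong (λ s → (toℕ a + s) % p) eq ⟩
    (toℕ a + c * p) % p        ≡⟨ [m+kn]%n≡m%n (toℕ a) c p ⟩
    toℕ a % p                  ≡⟨ m<n⇒m%n≡m (Finₚ.toℕ<n a) ⟩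
    toℕ a                      ∎
  by-cases (inj₂ n≤a) = trans (m<n⇒m%n≡m (ℕₚ.≤-<-trans n≤a (Finₚ.toℕ<n a)))
    (ℕₚ.≤-antisym n≤a (ℕₚ.m∸n≡0⇒m≤n (p∣d<p⇒d≡0 (toℕ a ∸ n)
      (subst (p ℕ∣.∣_) (ℤₚ.∣⊖∣-≤ n≤a) p∣n⊖a)
      (ℕₚ.≤-<-trans (ℕₚ.m∸n≤m (toℕ a) n) (Finₚ.toℕ<n a)))))

⊆-map⁻ : ∀ {A B : Set} (f : A → B) xs {ys} → ys ⊆ map f xs → ∃ λ zs → ys ≡ map f zs
⊆-map⁻ f []       []        = [] , refl
⊆-map⁻ f (x ∷ xs) (_ ∷ʳ τ)  = ⊆-map⁻ f xs τ
⊆-map⁻ f (x ∷ xs) (refl ∷ τ) with ⊆-map⁻ f xs τ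
... | zs , refl = x ∷ zs , refl

Unique-⊆ : ∀ {A : Set} {xs ys : List A} → xs ⊆ ys → Unique ys → Unique xs
Unique-⊆ []         u        = u
Unique-⊆ (y ∷ʳ τ)   (_ ∷ u)  = Unique-⊆ τ u
Unique-⊆ (refl ∷ τ) (y∉ ∷ u) = Sublistₚ.All-resp-⊆ τ y∉ ∷ Unique-⊆ τ u

AllPairs-∈-sym : ∀ {A : Set} {R : A → A → Set} {xs} → (∀ {x y} → R x y → R y x) → AllPairs R xs →
  ∀ {x y} → x ∈ xs → y ∈ xs → x ≢ y → R x y
AllPairs-∈-sym R-sym ps x∈ y∈ x≢y with ∈-AllPairs₂ ps x∈ y∈
... | inj₁ x≡y        = contradiction x≡y x≢y
... | inj₂ (inj₁ Rxy) = Rxy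
... | inj₂ (inj₂ Ryx) = R-sym Ryx

module Functions (k N : ℕ) where

  col : Fin (N ^ k) → Fin k → Fin N
  col = finToFun

  col-injective : ∀ {u v} → (∀ i → col u i ≡ col v i) → u ≡ v
  col-injective {u} {v} eq = trans (sym (Finₚ.funToFin-finToFin {k} {N} u))
    (trans (funToFin-cong eq) (Finₚ.funToFin-finToFin {k} {N} v))
    where
    funToFin-cong : ∀ {m n} {f g : Fin m → Fin n} → (∀ i → f i ≡ g i) → funToFin f ≡ funToFin g
    funToFin-cong {zero}  eq = refl
    funToFin-cong {suc m} eq = cong₂ combine (eq zero) (funToFin-cong (eq ∘ suc))

  open Agreement Finₚ._≟_ col col-injective public

  clique-bound : ∀ {q} → Prime (suc q) → (a : Fin (suc q)) → k % suc q ≢ toℕ a →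
    ∀ {us} → Unique us → (∀ {u v} → u ∈ us → v ∈ us → u ≢ v → ∃ λ c → ∣ agr u v ∣ ≡ c * suc q + toℕ a) →
    length us ≤ suc (k * N)
  clique-bound {q} p-prime a k≢a {us} unique clique = biorthogonal-≤ p-prime left right diagonal off-diagonal
    where
    block : Fin (length us) → Subset (k * N)
    block i = blocks k (col (List.lookup us i))
    left right : Fin (length us) → Fin (suc (k * N)) → ℤ
    left i  = (ℤ.- (ℤ.+ toℕ a)) VecF.∷ indicator (block i)
    right i = 1ℤ VecF.∷ indicator (block i)
    product : ∀ i j → dot (left i) (right j) ≡ ℤ.- (ℤ.+ toℕ a) ℤ.* 1ℤ ℤ.+ ℤ.+ ∣ block i ∩ block j ∣
    product i j = cong (ℤ._+_ (ℤ.- (ℤ.+ toℕ a) ℤ.* 1ℤ)) (dot-indicator (block i) (block j))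
    diagonal : ∀ i → ¬ (ℤ.+ suc q) ℤ∣.∣ dot (left i) (right i)
    diagonal i p∣ = k≢a (∣-a+n⇒n%p≡a a k (subst ((ℤ.+ suc q) ℤ∣.∣_)
      (trans (product i i) (cong (λ s → ℤ.- (ℤ.+ toℕ a) ℤ.* 1ℤ ℤ.+ ℤ.+ s)
        (trans (cong ∣_∣ (Subₚ.∩-idem (block i))) (∣blocks∣ k _)))) p∣))
    off-diagonal : ∀ i j → i ≢ j → (ℤ.+ suc q) ℤ∣.∣ dot (left i) (right j)
    off-diagonal i j i≢j with clique (∈-lookup i) (∈-lookup j) (i≢j ∘ lookup-injective unique i j)
    ... | c , eq = ℤ∣.divides (ℤ.+ c) (begin
      dot (left i) (right j)                      ≡⟨ product i j ⟩
      ℤ.- A ℤ.* 1ℤ ℤ.+ ℤ.+ ∣ block i ∩ block j ∣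
        ≡⟨ cong (λ s → ℤ.- A ℤ.* 1ℤ ℤ.+ ℤ.+ s) (trans (∣blocks∩blocks∣ k (col (List.lookup us i)) (col (List.lookup us j))) eq) ⟩
      ℤ.- A ℤ.* 1ℤ ℤ.+ ℤ.+ (c * suc q + toℕ a)    ≡⟨ cong (ℤ._+_ (ℤ.- A ℤ.* 1ℤ)) (ℤₚ.pos-+ (c * suc q) (toℕ a)) ⟩
      ℤ.- A ℤ.* 1ℤ ℤ.+ (ℤ.+ (c * suc q) ℤ.+ A)    ≡⟨ cancel A (ℤ.+ (c * suc q)) ⟩
      ℤ.+ (c * suc q)                             ≡⟨ ℤₚ.pos-* c (suc q) ⟩
      ℤ.+ c ℤ.* ℤ.+ suc q                         ∎)
      where
      open ≡-Reasoning
      A = ℤ.+ toℕ a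
      cancel : ∀ x y → ℤ.- x ℤ.* 1ℤ ℤ.+ (y ℤ.+ x) ≡ y
      cancel = ℤSolver.solve-∀

record Encoding (k k′ N : ℕ) : Set where
  open Functions k′ N using (agr)
  field
    size      : ℕ
    encode    : Fin (N ^ k′) → Subset size
    ∣encode∣  : ∀ u → ∣ encode u ∣ ≡ k
    ∣encode∩encode∣ : ∀ {u v} → u ≢ v → ∣ encode u ∩ encode v ∣ ≡ ∣ agr u v ∣

blockEncoding : ∀ k N → Encoding k k N
blockEncoding k N = record
  { encode          = blocks k ∘ finToFun
  ; ∣encode∣        = λ u → ∣blocks∣ k (finToFun u)
  ; ∣encode∩encode∣ = λ _ → ∣blocks∩blocks∣ k _ _
  }

privateEncoding : ∀ k N → Encoding (suc k) k N
privateEncoding k N = record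
  { encode          = λ u → blocks k (finToFun u) Vec.++ ⁅ u ⁆
  ; ∣encode∣        = λ u → trans (∣p++q∣≡∣p∣+∣q∣ (blocks k (finToFun u)) ⁅ u ⁆)
      (trans (cong₂ _+_ (∣blocks∣ k (finToFun u)) (Subₚ.∣⁅x⁆∣≡1 u)) (ℕₚ.+-comm k 1))
  ; ∣encode∩encode∣ = λ {u} {v} u≢v → trans (∣++∩++∣ (blocks k (finToFun u)) (blocks k (finToFun v)) ⁅ u ⁆ ⁅ v ⁆)
      (trans (cong₂ _+_ (∣blocks∩blocks∣ k _ _) (∣⁅x⁆∩⁅y⁆∣≡0 u≢v)) (ℕₚ.+-identityʳ _))
  }

avoidingConstant : ℕ → ℕ
avoidingConstant k = peelingConstant k (length (subsets k))

module _ {k k′ N : ℕ} (𝓔 : Encoding k k′ N) (k′≤k : k′ ≤ k)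
  {q : ℕ} (p-prime : Prime (suc q)) (a : Fin (suc q)) (k′≢a : k′ % suc q ≢ toℕ a) where
  open Encoding 𝓔
  open Functions k′ N

  family : Family size
  family = map encode (allFin (N ^ k′))

  encode-injective : ∀ {u v} → encode u ≡ encode v → u ≡ v
  encode-injective {u} {v} eq = decidable-stable (u Finₚ.≟ v) λ u≢v → ℕₚ.<⇒≱ (∣agr∣<k u≢v) (begin
    k′                       ≤⟨ k′≤k ⟩
    k                        ≡⟨ ∣encode∣ u ⟨
    ∣ encode u ∣             ≡⟨ cong ∣_∣ (Subₚ.∩-idem (encode u)) ⟨
    ∣ encode u ∩ encode u ∣  ≡⟨ cong (λ p → ∣ encode u ∩ p ∣) eq ⟩
    ∣ encode u ∩ encode v ∣  ≡⟨ ∣encode∩encode∣ u≢v ⟩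
    ∣ agr u v ∣              ∎)
    where open ℕₚ.≤-Reasoning

  family-unique : Unique family
  family-unique = Uniqueₚ.map⁺ encode-injective (Uniqueₚ.allFin⁺ _)

  family-k-sets : IsFamilyOfKSets k family
  family-k-sets = family-unique , Allₚ.map⁺ (All.universal ∣encode∣ _)

  length-family : length family ≡ N ^ k′
  length-family = trans (Listₚ.length-map encode (allFin (N ^ k′))) (Listₚ.length-tabulate id)

  agr-pairs : ∀ {R : ℕ → Set} {us} → AllPairs (λ A B → R ∣ A ∩ B ∣) (map encode us) →
    ∀ {u v} → u ∈ us → v ∈ us → u ≢ v → R ∣ agr u v ∣
  agr-pairs {R} ps u∈ v∈ u≢v = subst R (∣encode∩encode∣ u≢v)
    (AllPairs-∈-sym (λ {u} {v} → subst (λ p → R ∣ p ∣) (Subₚ.∩-comm (encode u) (encode v)))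
      (AllPairsₚ.map⁻ ps) u∈ v∈ u≢v)

  no-clique : ∀ {m} → suc (k′ * N) < m → ¬ HasLClique k (suc q) a m family
  no-clique {m} bound<m (C , C⊆ , C-unique , ∣C∣≡m , clique) with ⊆-map⁻ encode (allFin _) C⊆
  ... | us , refl = ℕₚ.<⇒≱ bound<m (subst (_≤ suc (k′ * N)) (trans (sym (Listₚ.length-map encode us)) ∣C∣≡m)
    (clique-bound p-prime a k′≢a (Uniqueₚ.map⁻ C-unique)
      λ u∈ v∈ u≢v → proj₂ (agr-pairs {R = InL' k (suc q) a} clique u∈ v∈ u≢v)))

  avoiding-subfamily-bound : .{{_ : NonZero N}} → ∀ {F} → F ⊆ family → AvoidsL k (suc q) a F →
    length F ≤ avoidingConstant k′ * N ^ ((k′ + suc q * (q * q)) / suc q)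
  avoiding-subfamily-bound {F} F⊆ avoids with ⊆-map⁻ encode (allFin _) F⊆
  ... | us , refl = subst (_≤ _) (sym (Listₚ.length-map encode us))
    (avoiding-bound p-prime a k′≢a (Uniqueₚ.map⁻ (Unique-⊆ F⊆ family-unique)) λ {u} {v} u∈ v∈ u≢v eq →
      agr-pairs {R = λ ℓ → ¬ InL' k (suc q) a ℓ} avoids u∈ v∈ u≢v
        (ℕₚ.<-≤-trans (∣agr∣<k u≢v) k′≤k , ∣ agr u v ∣ / suc q ,
         trans (m≡m%n+[m/n]*n ∣ agr u v ∣ (suc q)) (trans (ℕₚ.+-comm (∣ agr u v ∣ % suc q) _) (cong (∣ agr u v ∣ / suc q * suc q +_) eq))))

  admissible-bound : .{{_ : NonZero N}} → ∀ {m α} → suc (k′ * N) < m → Admissible k (suc q) a m α →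
    ∃ λ r → r ≤ avoidingConstant k′ * N ^ ((k′ + suc q * (q * q)) / suc q) ×
      α Q.* ℕ→ℚ (N ^ k′) Q.≤ ℕ→ℚ r
  admissible-bound {α = α} bound<m (0≤α , admissible) with admissible size family family-k-sets (no-clique bound<m)
  ... | F , F⊆ , avoids , α∣family∣≤∣F∣ = length F , avoiding-subfamily-bound F⊆ avoids ,
    subst (λ s → α Q.* ℕ→ℚ s Q.≤ ℕ→ℚ (length F)) length-family α∣family∣≤∣F∣

-- Rational estimates

toℚᵘ-ℕ→ℚ : ∀ n → Q.toℚᵘ (ℕ→ℚ n) ℚᵘ.≃ mkℚᵘ (ℤ.+ n) 0
toℚᵘ-ℕ→ℚ n = ℚₚ.toℚᵘ-fromℚᵘ (mkℚᵘ (ℤ.+ n) 0)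

ℕ→ℚ-* : ∀ m n → ℕ→ℚ (m * n) ≡ ℕ→ℚ m Q.* ℕ→ℚ n
ℕ→ℚ-* m n = ℚₚ.toℚᵘ-injective (begin
  Q.toℚᵘ (ℕ→ℚ (m * n))                ≈⟨ toℚᵘ-ℕ→ℚ (m * n) ⟩
  mkℚᵘ (ℤ.+ (m * n)) 0                ≈⟨ ℚᵘₚ.≃-reflexive (cong (λ i → mkℚᵘ i 0) (ℤₚ.pos-* m n)) ⟩
  mkℚᵘ (ℤ.+ m) 0 ℚᵘ.* mkℚᵘ (ℤ.+ n) 0  ≈⟨ ℚᵘₚ.*-cong (toℚᵘ-ℕ→ℚ m) (toℚᵘ-ℕ→ℚ n) ⟨
  Q.toℚᵘ (ℕ→ℚ m) ℚᵘ.* Q.toℚᵘ (ℕ→ℚ n)  ≈⟨ ℚₚ.toℚᵘ-homo-* (ℕ→ℚ m) (ℕ→ℚ n) ⟨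
  Q.toℚᵘ (ℕ→ℚ m Q.* ℕ→ℚ n)            ∎)
  where open ℚᵘₚ.≃-Reasoning

ℕ→ℚ-mono-≤ : ∀ {m n} → m ≤ n → ℕ→ℚ m Q.≤ ℕ→ℚ n
ℕ→ℚ-mono-≤ {m} {n} m≤n = ℚₚ.toℚᵘ-cancel-≤ (begin
  Q.toℚᵘ (ℕ→ℚ m)  ≃⟨ toℚᵘ-ℕ→ℚ m ⟩
  mkℚᵘ (ℤ.+ m) 0  ≤⟨ ℚᵘ.*≤* (ℤₚ.*-monoʳ-≤-nonNeg (ℤ.+ 1) (ℤ.+≤+ m≤n)) ⟩
  mkℚᵘ (ℤ.+ n) 0  ≃⟨ toℚᵘ-ℕ→ℚ n ⟨
  Q.toℚᵘ (ℕ→ℚ n)  ∎)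
  where open ℚᵘₚ.≤-Reasoning

ℕ→ℚ-pos : ∀ n → .{{NonZero n}} → Q.Positive (ℕ→ℚ n)
ℕ→ℚ-pos n = ℚₚ.normalize-pos n 1

ℕ→ℚ-^ : ∀ m n → ℕ→ℚ (m ^ n) ≡ ℕ→ℚ m ^ℚ n
ℕ→ℚ-^ m zero    = refl
ℕ→ℚ-^ m (suc n) = trans (ℕ→ℚ-* m (m ^ n)) (cong (ℕ→ℚ m Q.*_) (ℕ→ℚ-^ m n))

*-^ℚ : ∀ x y n → (x Q.* y) ^ℚ n ≡ (x ^ℚ n) Q.* (y ^ℚ n)
*-^ℚ x y zero    = refl
*-^ℚ x y (suc n) = trans (cong (x Q.* y Q.*_) (*-^ℚ x y n)) (interchange x y (x ^ℚ n) (y ^ℚ n))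
  where open CommutativeSemigroupₚ (CommutativeMonoid.commutativeSemigroup ℚₚ.*-1-commutativeMonoid)

^ℚ-nonNeg : ∀ x n → .{{Q.NonNegative x}} → Q.NonNegative (x ^ℚ n)
^ℚ-nonNeg x zero    = _
^ℚ-nonNeg x (suc n) = ℚₚ.nonNeg*nonNeg⇒nonNeg x (x ^ℚ n) {{^ℚ-nonNeg x n}}

^ℚ-mono-≤ : ∀ {x y} n → .{{Q.NonNegative x}} → x Q.≤ y → x ^ℚ n Q.≤ y ^ℚ n
^ℚ-mono-≤ zero    x≤y = ℚₚ.≤-refl
^ℚ-mono-≤ {x} {y} (suc n) x≤y = begin
  x Q.* x ^ℚ n  ≤⟨ ℚₚ.*-monoˡ-≤-nonNeg x (^ℚ-mono-≤ n x≤y) ⟩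
  x Q.* y ^ℚ n  ≤⟨ ℚₚ.*-monoʳ-≤-nonNeg (y ^ℚ n) {{^ℚ-nonNeg y n {{y≥0}}}} x≤y ⟩
  y Q.* y ^ℚ n  ∎
  where
  open ℚₚ.≤-Reasoning
  y≥0 : Q.NonNegative y
  y≥0 = Q.nonNegative (ℚₚ.≤-trans (ℚₚ.nonNegative⁻¹ x) x≤y)

rescale-≤ : ∀ {β X Y X′ Y′} W K → .{{Q.NonNegative β}} → .{{NonZero W}} → β Q.* ℕ→ℚ X Q.≤ ℕ→ℚ Y →
  X′ * W ≤ X * K → Y * K ≤ Y′ * W → β Q.* ℕ→ℚ X′ Q.≤ ℕ→ℚ Y′
rescale-≤ {β} {X} {Y} {X′} {Y′} W K βX≤Y X′W≤XK YK≤Y′W = ℚₚ.*-cancelʳ-≤-pos (ℕ→ℚ W) {{ℕ→ℚ-pos W}} (begin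
  β Q.* ℕ→ℚ X′ Q.* ℕ→ℚ W    ≡⟨ ℚₚ.*-assoc β (ℕ→ℚ X′) (ℕ→ℚ W) ⟩
  β Q.* (ℕ→ℚ X′ Q.* ℕ→ℚ W)  ≡⟨ cong (β Q.*_) (ℕ→ℚ-* X′ W) ⟨
  β Q.* ℕ→ℚ (X′ * W)        ≤⟨ ℚₚ.*-monoˡ-≤-nonNeg β (ℕ→ℚ-mono-≤ X′W≤XK) ⟩
  β Q.* ℕ→ℚ (X * K)         ≡⟨ cong (β Q.*_) (ℕ→ℚ-* X K) ⟩
  β Q.* (ℕ→ℚ X Q.* ℕ→ℚ K)   ≡⟨ ℚₚ.*-assoc β (ℕ→ℚ X) (ℕ→ℚ K) ⟨
  β Q.* ℕ→ℚ X Q.* ℕ→ℚ K     ≤⟨ ℚₚ.*-monoʳ-≤-nonNeg (ℕ→ℚ K) {{ℚₚ.normalize-nonNeg K 1}} βX≤Y ⟩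
  ℕ→ℚ Y Q.* ℕ→ℚ K           ≡⟨ ℕ→ℚ-* Y K ⟨
  ℕ→ℚ (Y * K)               ≤⟨ ℕ→ℚ-mono-≤ YK≤Y′W ⟩
  ℕ→ℚ (Y′ * W)              ≡⟨ ℕ→ℚ-* Y′ W ⟩
  ℕ→ℚ Y′ Q.* ℕ→ℚ W          ∎)
  where open ℚₚ.≤-Reasoning

^-distribʳ-* : ∀ m n o → (m * n) ^ o ≡ m ^ o * n ^ o
^-distribʳ-* m n zero    = refl
^-distribʳ-* m n (suc o) = trans (cong (m * n *_) (^-distribʳ-* m n o)) (interchange m n (m ^ o) (n ^ o))
  where open CommutativeSemigroupₚ ℕₚ.*-commutativeSemigroup

exponent-bound : ∀ {q k k′ e} → k ≤ suc k′ → suc q * e ≤ k′ + suc q * (q * q) →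
  q * k + e * suc q ≤ k′ * suc q + suc q ^ 3
exponent-bound {q} {k} {k′} {e} k≤ pe≤ = begin
  q * k + e * suc q
    ≤⟨ ℕₚ.+-mono-≤ (ℕₚ.*-monoʳ-≤ q k≤) (subst (_≤ k′ + suc q * (q * q)) (ℕₚ.*-comm (suc q) e) pe≤) ⟩
  q * suc k′ + (k′ + suc q * (q * q))                              ≤⟨ ℕₚ.m≤m+n _ (2 * (q * q) + 2 * q + 1) ⟩
  q * suc k′ + (k′ + suc q * (q * q)) + (2 * (q * q) + 2 * q + 1)  ≡⟨ expand q k′ ⟩
  k′ * suc q + suc q ^ 3                                           ∎
  where
  open ℕₚ.≤-Reasoning
  expand : ∀ q k → q * (1 + k) + (k + (1 + q) * (q * q)) + (2 * (q * q) + 2 * q + 1)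
    ≡ k * (1 + q) + (1 + q) * ((1 + q) * ((1 + q) * 1))
  expand = ℕSolver.solve-∀

power-bound : ∀ {k k′ q e m N B D α} → .{{NonZero N}} → .{{NonZero D}} → 0ℚ Q.≤ α →
  k ≤ suc k′ → suc q * e ≤ k′ + suc q * (q * q) → N ≤ m → m ≤ D * N →
  α Q.* ℕ→ℚ (N ^ k′) Q.≤ ℕ→ℚ (B * N ^ e) →
  (α ^ℚ suc q) Q.* ℕ→ℚ (m ^ (q * k)) Q.≤ (ℕ→ℚ (B * D ^ k) ^ℚ suc q) Q.* ℕ→ℚ (m ^ (suc q ^ 3))
power-bound {k} {k′} {q} {e} {m} {N} {B} {D} {α} 0≤α k≤ pe≤ N≤m m≤DN α≤ =
  subst ((α ^ℚ p) Q.* ℕ→ℚ (m ^ (q * k)) Q.≤_)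
    (trans (ℕ→ℚ-* ((B * D ^ k) ^ p) (m ^ (p ^ 3))) (cong (Q._* ℕ→ℚ (m ^ (p ^ 3))) (ℕ→ℚ-^ (B * D ^ k) p)))
    (rescale-≤ {β = α ^ℚ p} {X = (N ^ k′) ^ p} {Y = (B * N ^ e) ^ p} {X′ = m ^ (q * k)} {Y′ = (B * D ^ k) ^ p * m ^ (p ^ 3)} W (D ^ (q * k) * N ^ (p ^ 3))
      {{^ℚ-nonNeg α p}} {{W≢0}} powered lower upper)
  where
  open ℕₚ.≤-Reasoning
  p = suc q
  W = N ^ (e * p)
  instance
    α≥0 : Q.NonNegative α
    α≥0 = Q.nonNegative 0≤α
  W≢0 : NonZero W
  W≢0 = ℕₚ.m^n≢0 N (e * p)
  powered : (α ^ℚ p) Q.* ℕ→ℚ ((N ^ k′) ^ p) Q.≤ ℕ→ℚ ((B * N ^ e) ^ p)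
  powered = subst₂ Q._≤_
    (trans (*-^ℚ α (ℕ→ℚ (N ^ k′)) p) (cong ((α ^ℚ p) Q.*_) (sym (ℕ→ℚ-^ (N ^ k′) p))))
    (sym (ℕ→ℚ-^ (B * N ^ e) p))
    (^ℚ-mono-≤ p {{ℚₚ.nonNeg*nonNeg⇒nonNeg α (ℕ→ℚ (N ^ k′)) {{ℚₚ.normalize-nonNeg (N ^ k′) 1}}}} α≤)
  lower : m ^ (q * k) * W ≤ (N ^ k′) ^ p * (D ^ (q * k) * N ^ (p ^ 3))
  lower = begin
    m ^ (q * k) * W                             ≤⟨ ℕₚ.*-monoˡ-≤ W (ℕₚ.^-monoˡ-≤ (q * k) m≤DN) ⟩
    (D * N) ^ (q * k) * W                       ≡⟨ cong (_* W) (^-distribʳ-* D N (q * k)) ⟩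
    D ^ (q * k) * N ^ (q * k) * W               ≡⟨ ℕₚ.*-assoc (D ^ (q * k)) _ W ⟩
    D ^ (q * k) * (N ^ (q * k) * W)             ≡⟨ cong (D ^ (q * k) *_) (ℕₚ.^-distribˡ-+-* N (q * k) (e * p)) ⟨
    D ^ (q * k) * N ^ (q * k + e * p)
      ≤⟨ ℕₚ.*-monoʳ-≤ (D ^ (q * k)) (ℕₚ.^-monoʳ-≤ N (exponent-bound {q} {k} {k′} {e} k≤ pe≤)) ⟩
    D ^ (q * k) * N ^ (k′ * p + p ^ 3)          ≡⟨ cong (D ^ (q * k) *_) (ℕₚ.^-distribˡ-+-* N (k′ * p) (p ^ 3)) ⟩
    D ^ (q * k) * (N ^ (k′ * p) * N ^ (p ^ 3))  ≡⟨ x∙yz≈y∙xz (D ^ (q * k)) (N ^ (k′ * p)) (N ^ (p ^ 3)) ⟩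
    N ^ (k′ * p) * (D ^ (q * k) * N ^ (p ^ 3))  ≡⟨ cong (_* (D ^ (q * k) * N ^ (p ^ 3))) (ℕₚ.^-*-assoc N k′ p) ⟨
    (N ^ k′) ^ p * (D ^ (q * k) * N ^ (p ^ 3))  ∎
    where open CommutativeSemigroupₚ ℕₚ.*-commutativeSemigroup
  qk≤kp : q * k ≤ k * p
  qk≤kp = subst (q * k ≤_) (ℕₚ.*-comm p k) (ℕₚ.m≤n+m (q * k) k)
  upper : (B * N ^ e) ^ p * (D ^ (q * k) * N ^ (p ^ 3)) ≤ (B * D ^ k) ^ p * m ^ (p ^ 3) * W
  upper = begin
    (B * N ^ e) ^ p * (D ^ (q * k) * N ^ (p ^ 3))
      ≡⟨ cong (_* (D ^ (q * k) * N ^ (p ^ 3))) (trans (^-distribʳ-* B (N ^ e) p) (cong (B ^ p *_) (ℕₚ.^-*-assoc N e p))) ⟩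
    B ^ p * W * (D ^ (q * k) * N ^ (p ^ 3))
      ≤⟨ ℕₚ.*-monoʳ-≤ (B ^ p * W) (ℕₚ.*-mono-≤ (ℕₚ.^-monoʳ-≤ D qk≤kp) (ℕₚ.^-monoˡ-≤ (p ^ 3) N≤m)) ⟩
    B ^ p * W * (D ^ (k * p) * m ^ (p ^ 3))        ≡⟨ rearrange (B ^ p) W (D ^ (k * p)) (m ^ (p ^ 3)) ⟩
    B ^ p * D ^ (k * p) * m ^ (p ^ 3) * W
      ≡⟨ cong (λ s → s * m ^ (p ^ 3) * W) (trans (^-distribʳ-* B (D ^ k) p) (cong (B ^ p *_) (ℕₚ.^-*-assoc D k p))) ⟨
    (B * D ^ k) ^ p * m ^ (p ^ 3) * W              ∎
    where
    rearrange : ∀ b w d n → b * w * (d * n) ≡ b * d * n * w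
    rearrange = ℕSolver.solve-∀

admissible-≤1 : ∀ {k p} {a : Fin p} {m α} → 2 ≤ m → Admissible k p a m α → α Q.≤ 1ℚ
admissible-≤1 {k} {p} {a} {m} {α} 2≤m (_ , admissible)
  with admissible k (⊤ ∷ []) (([] ∷ []) , (Subₚ.∣⊤∣≡n k ∷ []))
         (λ (C , C⊆ , _ , ∣C∣≡m , _) → ℕₚ.<⇒≱ 2≤m (subst (_≤ 1) ∣C∣≡m (Sublistₚ.length-mono-≤ C⊆)))
... | F , F⊆ , _ , α≤ = ℚₚ.≤-trans (subst (Q._≤ ℕ→ℚ (length F)) (ℚₚ.*-identityʳ α) α≤)
                                   (ℕ→ℚ-mono-≤ (Sublistₚ.length-mono-≤ F⊆))

bound : ℕ → ℕ
bound k = suc (avoidingConstant k + avoidingConstant (k ∸ 1))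

avoidingConstant≤bound : ∀ k → avoidingConstant k ≤ bound k
avoidingConstant≤bound k = ℕₚ.m≤n⇒m≤1+n (ℕₚ.m≤m+n (avoidingConstant k) _)

avoidingConstant-pred≤bound : ∀ k → avoidingConstant (k ∸ 1) ≤ bound k
avoidingConstant-pred≤bound k = ℕₚ.m≤n⇒m≤1+n (ℕₚ.m≤n+m _ (avoidingConstant k))

-- Choosing between the plain encoding and the one with a private element makes the number of
-- coordinates incongruent to a, as the clique bound requires.
encoding-with-incongruent-size : ∀ {q} → Prime (suc q) → (a : Fin (suc q)) → ∀ k → 1 ≤ k → ∀ N →
  ∃ λ k′ → Encoding k k′ N × k′ ≤ k × k ≤ suc k′ × k′ % suc q ≢ toℕ a × avoidingConstant k′ ≤ bound k
encoding-with-incongruent-size {q} p-prime a k@(suc k′) 1≤k N with k % suc q ℕ.≟ toℕ a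
... | no k≢a  = k , blockEncoding k N , ℕₚ.≤-refl , ℕₚ.n≤1+n k , k≢a , avoidingConstant≤bound k
... | yes k≡a = k′ , privateEncoding k′ N , ℕₚ.n≤1+n k′ , ℕₚ.≤-refl , k′≢a , avoidingConstant-pred≤bound k
  where
  k′≢a : k′ % suc q ≢ toℕ a
  k′≢a k′≡a = ¬prime[1] (subst Prime (ℕ∣.∣1⇒≡1 (%≡⇒∣∸ (suc q) {k′} {1}
    (trans k′≡a (trans (sym k≡a) (cong (_% suc q) (ℕₚ.+-comm 1 k′)))))) p-prime)

large-clique-bound : ∀ {k q m N α} → Prime (suc q) → (a : Fin (suc q)) → 1 ≤ k → .{{NonZero N}} →
  suc (k * N) < m → m ≤ (2 + 2 * k) * N → Admissible k (suc q) a m α →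
  (α ^ℚ suc q) Q.* ℕ→ℚ (m ^ (q * k)) Q.≤
    (ℕ→ℚ (bound k * (2 + 2 * k) ^ k) ^ℚ suc q) Q.* ℕ→ℚ (m ^ (suc q ^ 3))
large-clique-bound {k} {q} {m} {N} {α} p-prime a 1≤k kN<m m≤DN adm =
  encoded (encoding-with-incongruent-size p-prime a k 1≤k N)
  where
  Goal = (α ^ℚ suc q) Q.* ℕ→ℚ (m ^ (q * k)) Q.≤
    (ℕ→ℚ (bound k * (2 + 2 * k) ^ k) ^ℚ suc q) Q.* ℕ→ℚ (m ^ (suc q ^ 3))
  module _ (k′ : ℕ) (k≤1+k′ : k ≤ suc k′) (c≤bound : avoidingConstant k′ ≤ bound k) where
    e = (k′ + suc q * (q * q)) / suc q
    bounded : (∃ λ r → r ≤ avoidingConstant k′ * N ^ e × α Q.* ℕ→ℚ (N ^ k′) Q.≤ ℕ→ℚ r) → Goal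
    bounded (r , r≤ , α≤r) = power-bound {k} {k′} {q} {e} {m} {N} {bound k} {2 + 2 * k} {α} (proj₁ adm) k≤1+k′
      (subst (_≤ k′ + suc q * (q * q)) (ℕₚ.*-comm e (suc q)) (m/n*n≤m _ (suc q)))
      N≤m m≤DN
      (ℚₚ.≤-trans α≤r (ℕ→ℚ-mono-≤ {r} {bound k * N ^ e} (ℕₚ.≤-trans r≤ (ℕₚ.*-monoˡ-≤ (N ^ e) c≤bound))))
      where
      N≤m : N ≤ m
      N≤m = ℕₚ.≤-trans (ℕₚ.m≤n*m N k {{ℕ.>-nonZero 1≤k}}) (ℕₚ.≤-trans (ℕₚ.n≤1+n (k * N)) (ℕₚ.<⇒≤ kN<m))
  encoded : (∃ λ k′ → Encoding k k′ N × k′ ≤ k × k ≤ suc k′ × k′ % suc q ≢ toℕ a × avoidingConstant k′ ≤ bound k) → Goal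
  encoded (k′ , 𝓔 , k′≤k , k≤1+k′ , k′≢a , c≤bound) = bounded k′ k≤1+k′ c≤bound
    (admissible-bound 𝓔 k′≤k p-prime a k′≢a {m} {α} (ℕₚ.≤-<-trans (s≤s (ℕₚ.*-monoˡ-≤ N k′≤k)) kN<m) adm)

small-clique-bound : ∀ {k q m α} → (a : Fin (suc q)) → 2 ≤ m → m ≤ 2 + 2 * k → Admissible k (suc q) a m α →
  (α ^ℚ suc q) Q.* ℕ→ℚ (m ^ (q * k)) Q.≤
    (ℕ→ℚ (bound k * (2 + 2 * k) ^ k) ^ℚ suc q) Q.* ℕ→ℚ (m ^ (suc q ^ 3))
small-clique-bound {k} {q} {m} {α} a 2≤m m≤D adm = power-bound {k} {k} {q} {0} {m} {1} {bound k} {2 + 2 * k} {α} (proj₁ adm) (ℕₚ.n≤1+n k)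
  (subst (_≤ k + suc q * (q * q)) (sym (ℕₚ.*-zeroʳ q)) z≤n) (ℕₚ.<⇒≤ 2≤m)
  (subst (m ≤_) (sym (ℕₚ.*-identityʳ _)) m≤D)
  (ℚₚ.≤-trans (subst (Q._≤ 1ℚ) (sym α*1) (admissible-≤1 {k} {suc q} {a} {m} {α} 2≤m adm)) (ℕ→ℚ-mono-≤ {1} {bound k * 1 ^ 0} (s≤s z≤n)))
  where
  α*1 : α Q.* ℕ→ℚ (1 ^ k) ≡ α
  α*1 = trans (cong (λ s → α Q.* ℕ→ℚ s) (ℕₚ.^-zeroˡ k)) (ℚₚ.*-identityʳ α)

clique-bound-estimate : ∀ {k q m α} → Prime (suc q) → (a : Fin (suc q)) → 1 ≤ k → 2 ≤ m →
  Admissible k (suc q) a m α →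
  (α ^ℚ suc q) Q.* ℕ→ℚ (m ^ (q * k)) Q.≤
    (ℕ→ℚ (bound k * (2 + 2 * k) ^ k) ^ℚ suc q) Q.* ℕ→ℚ (m ^ (suc q ^ 3))
clique-bound-estimate {k@(suc _)} {q} {suc (suc m)} {α} p-prime a 1≤k 2≤m@(s≤s (s≤s z≤n)) adm =
  by-size (k ℕ.≤? m)
  where
  N = m / k
  m≤DN : k ≤ m → suc (suc m) ≤ (2 + 2 * k) * N
  m≤DN k≤m = begin
    2 + m                ≡⟨ cong (2 +_) (m≡m%n+[m/n]*n m k) ⟩
    2 + (m % k + N * k)  ≤⟨ ℕₚ.+-monoʳ-≤ 2 (ℕₚ.+-monoˡ-≤ (N * k) (ℕₚ.<⇒≤ (m%n<n m k))) ⟩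
    2 + (k + N * k)      ≡⟨ ℕₚ.+-assoc 2 k (N * k) ⟨
    2 + k + N * k        ≤⟨ ℕₚ.+-monoˡ-≤ (N * k) (ℕₚ.m≤m*n (2 + k) N {{ℕ.>-nonZero (m≥n⇒m/n>0 k≤m)}}) ⟩
    (2 + k) * N + N * k  ≡⟨ factor k N ⟩
    (2 + 2 * k) * N      ∎
    where
    open ℕₚ.≤-Reasoning
    factor : ∀ k n → (2 + k) * n + n * k ≡ (2 + 2 * k) * n
    factor = ℕSolver.solve-∀
  by-size : Dec (k ≤ m) → _
  by-size (no k≰m)  = small-clique-bound {k} {q} {2 + m} {α} a 2≤m
    (s≤s (s≤s (ℕₚ.≤-trans (ℕₚ.<⇒≤ (ℕₚ.≰⇒> k≰m)) (ℕₚ.m≤m+n k _)))) adm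
  by-size (yes k≤m) = large-clique-bound {k} {q} {2 + m} {N} {α} p-prime a 1≤k {{ℕ.>-nonZero (m≥n⇒m/n>0 k≤m)}}
    (s≤s (s≤s (subst (_≤ m) (ℕₚ.*-comm N k) (m/n*n≤m m k)))) (m≤DN k≤m) adm

theorem5p3 : (k : ℕ) → 1 ≤ k →
    Σ ℚ λ C → (0ℚ Q.< C) ×
    ((p : ℕ) → Prime p → (a : Fin p) → (m : ℕ) → 2 ≤ m →
    (α : ℚ) → Admissible k p a m α →
    (α ^ℚ p) Q.* ℕ→ℚ (m ^ ((p ∸ 1) * k)) Q.≤ (C ^ℚ p) Q.* ℕ→ℚ (m ^ (p ^ 3)))
theorem5p3 k 1≤k = ℕ→ℚ C , ℚₚ.positive⁻¹ (ℕ→ℚ C) {{ℕ→ℚ-pos C {{C≢0}}}} ,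
  λ { (suc q) p-prime a m 2≤m α → clique-bound-estimate {k} {q} {m} {α} p-prime a 1≤k 2≤m }
  where
  C = bound k * (2 + 2 * k) ^ k
  C≢0 : NonZero C
  C≢0 = ℕₚ.m*n≢0 (bound k) ((2 + 2 * k) ^ k) {{_}} {{ℕₚ.m^n≢0 (2 + 2 * k) k}}
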